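{- Let $q>3$ be a prime power and let $t>1$ be an integer. Let $L=L_U$ be a scattered $\mathbb F_q$-linear set of maximum rank $t$ in $\mathrm{PG}(1,q^t)$, and let $c=c_\Gamma(L)$ be its $\Gamma\mathrm L$-class. Then $L$ gives rise to $c$ pairwise non-isomorphic translation planes; that is, there exist a projectivity $\kappa$ of $\mathrm{PG}(1,q^t)$ and scattered $\mathbb F_q$-linearized polynomials $f_1(x),\dots,f_c(x)\in\mathbb F_{q^t}[x]$ such that $L_{U_{f_i}}=\kappa(L)$ for every $i\in\{1,\dots,c\}$ and the translation planes $\mathcal A_{f_1},\dots,\mathcal A_{f_c}$ are pairwise non-isomorphic.
   Context: For an $\mathbb F_q$-subspace $U$ of $\mathbb F_{q^t}^2$ of $\mathbb F_q$-dimension $r>0$, the $\mathbb F_q$-linear set of rank $r$ defined by $U$ is the point set $L_U=\{\langle v\rangle_{\mathbb F_{q^t}} : v\in U\setminus\{0\}\}$ of $\mathrm{PG}(1,q^t)$. It is scattered if $\#L_U=(q^r-1)/(q-1)$, equivalently $\dim_{\mathbb F_q}(U\cap\langle v\rangle_{\mathbb F_{q^t}})\le 1$ for every $v\in\mathbb F_{q^t}^2$. Scattered linear sets in $\mathrm{PG}(1,q^t)$ have rank at most $t$; those of rank $t$ are said to be of maximum rank. Let $\Gamma\mathrm L(2,q^t)$ be the group of bijective $\mathbb F_{q^t}$-semilinear maps of $\mathbb F_{q^t}^2$. For an $\mathbb F_q$-linear set $L$ of maximum rank in $\mathrm{PG}(1,q^t)$ whose maximum field of linearity is $\mathbb F_q$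 (i.e. $L$ is not an $\mathbb F_{q^r}$-linear set for any $r>1$; this is the case for scattered $L$ of maximum rank), the $\Gamma\mathrm L$-class $c_\Gamma(L)$ is the largest integer $c$ such that there exist $\mathbb F_q$-subspaces $U_1,\dots,U_c$ of $\mathbb F_{q^t}^2$ with $L_{U_i}=L$ for all $i$ and such that for $i\ne j$ there is no $\kappa\in\Gamma\mathrm L(2,q^t)$ with $U_i=\kappa(U_j)$. An $\mathbb F_q$-linearized polynomial in $\mathbb F_{q^t}[x]$ is one of the form $f(x)=\sum_{i=0}^k a_ix^{q^i}$. It is scattered if for all $y,z\in\mathbb F_{q^t}$ the condition $zf(y)-yf(z)=0$ implies that $y$ and $z$ are $\mathbb F_q$-linearly dependent. For a scattered $f$ put $U_f=\{(x,f(x)) : x\in\mathbb F_{q^t}\}$ and $L_f=\{f(x)/x : x\in\mathbb F_{q^t}^*\}\subseteq\mathbb F_{q^t}$ (the nonhomogeneous coordinates of the points of $L_{U_f}$). A planar spread of a vector space $\mathbb V$ is a collection $\mathcal B$ of at least three subspaces such that $\mathbb V=V\oplus V'$ for all distinct $V,V'\in\mathcal B$ and every vector of $\mathbb V$ lies in some member of $\mathcal B$. The translation plane $\mathcal A(\mathcal B)$ is the affine plane whose points are the vectors of $\mathbb V$ and whose lines are the cosets $V+w$ ($V\in\mathcal B$, $w\in\mathbb V$). Let $\mathcal B_f$ be the collection consisting of the following subspaces of $\mathbb F_{q^t}^2$: $\langle(1,m)\rangle_{\mathbb F_{q^t}}$ for $m\in\mathbb F_{q^t}\setminus L_f$; $hU_f=\{hv:v\in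 U_f\}$ for $h\in\mathbb F_{q^t}^*$; and $\{0\}\times\mathbb F_{q^t}$. This is a planar spread of $\mathbb F_{q^t}^2$ (as an $\mathbb F_q$-vector space), and the translation plane associated with $f$ is $\mathcal A_f=\mathcal A(\mathcal B_f)$. Two planes are isomorphic if there is a bijection between their point sets that maps lines onto lines (in both directions). -}

module Defs where

open import Level using (0ℓ)
open import Algebra.Bundles using (CommutativeRing)
open import Algebra.Bundles.Raw using (RawMonoid; RawRing)
open import Algebra.Structures using (IsCommutativeRing)
open import Algebra.Morphism.Structures using (IsRingHomomorphism; IsRingIsomorphism)
import Algebra.Definitions.RawMonoid as RawMonoidOps
import Algebra.Definitions.RawSemiring as RawSemiringOps
open import Data.Fin using (Fin; toℕ)
open import Data.Nat as ℕ using (ℕ; suc; _∸_; _≤_)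
open import Data.Nat.Primality using (Prime)
open import Data.Product using (Σ; ∃; ∃₂; ∃-syntax; _×_; _,_; proj₁; proj₂)
open import Data.Vec.Functional using (Vector)
open import Function.Base using (id; _∘_)
open import Function.Bundles using (_↔_)
open import Function.Definitions using (Bijective)
open import Relation.Binary.PropositionalEquality using (_≡_; _≢_; refl; sym; trans; cong)
open import Relation.Nullary using (¬_)
open import Relation.Unary using (Pred; Decidable; _≐_) renaming (_∈_ to _∈ₛ_; _∉_ to _∉ₛ_)

IsPrimePower : ℕ → Set
IsPrimePower q = ∃₂ λ p k → Prime p × 1 ≤ k × q ≡ p ℕ.^ k

-- The value of _⁻¹ at 0# is unconstrained.
record FiniteField (n : ℕ) : Set₁ where
  infix  8 _⁻¹
  infixl 7 _*_
  infixl 6 _+_ _-_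
  field
    Carrier           : Set
    _+_ _*_           : Carrier → Carrier → Carrier
    -_                : Carrier → Carrier
    0# 1#             : Carrier
    _⁻¹               : Carrier → Carrier
    isCommutativeRing : IsCommutativeRing _≡_ _+_ _*_ -_ 0# 1#
    0≢1               : 0# ≢ 1#
    *-inverseʳ        : ∀ x → x ≢ 0# → x * x ⁻¹ ≡ 1#
    enumeration       : Carrier ↔ Fin n

  commutativeRing : CommutativeRing 0ℓ 0ℓ
  commutativeRing = record { isCommutativeRing = isCommutativeRing }

  open CommutativeRing commutativeRing public
    using (rawRing; +-rawMonoid; zeroˡ)
  open RawRing rawRing public using (rawSemiring)

  _-_ : Carrier → Carrier → Carrier
  x - y = x + (- y)

-- 𝔽_q ⊆ 𝔽_{q^t}, the inclusion being a ring homomorphism ι.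
record FieldExtension (q t : ℕ) : Set₁ where
  field
    𝕂     : FiniteField q
    𝔽     : FiniteField (q ℕ.^ t)
    ι     : FiniteField.Carrier 𝕂 → FiniteField.Carrier 𝔽
    ι-hom : IsRingHomomorphism (FiniteField.rawRing 𝕂) (FiniteField.rawRing 𝔽) ι

record IncidenceStructure : Set₁ where
  field
    Point : Set
    Line  : Set
    _on_  : Point → Line → Set

image : {A B : Set} → (A → B) → Pred A 0ℓ → Pred B 0ℓ
image φ S b = ∃[ a ] (a ∈ₛ S × φ a ≡ b)

-- The last two conditions say that both φ and its inverse map lines onto lines.
_≅_ : IncidenceStructure → IncidenceStructure → Set
A ≅ B = ∃[ φ ] (Bijective _≡_ _≡_ φ
               × (∀ ℓ → ∃[ m ] (image φ (A._on ℓ) ≐ (B._on m)))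
               × (∀ m → ∃[ ℓ ] (image φ (A._on ℓ) ≐ (B._on m))))
  where
    module A = IncidenceStructure A
    module B = IncidenceStructure B

module Geometry {q t : ℕ} (E : FieldExtension q t) where

  open FieldExtension E public
  private module K = FiniteField 𝕂
  open FiniteField 𝔽 using (_+_; _*_; _-_; _⁻¹; 0#; 1#; rawRing; rawSemiring; +-rawMonoid; zeroˡ)
  open RawSemiringOps rawSemiring using (_^_)

  F : Set
  F = FiniteField.Carrier 𝔽

  V : Set
  V = F × F

  0ᵥ : V
  0ᵥ = 0# , 0#

  infixl 6 _+ᵥ_
  infixr 7 _·_ _·ₖ_

  _+ᵥ_ : V → V → V
  (a , b) +ᵥ (c , d) = (a + c) , (b + d)

  _·_ : F → V → V
  x · (a , b) = (x * a) , (x * b)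

  _·ₖ_ : K.Carrier → V → V
  a ·ₖ v = ι a · v

  +ᵥ-rawMonoid : RawMonoid 0ℓ 0ℓ
  +ᵥ-rawMonoid = record { Carrier = V ; _≈_ = _≡_ ; _∙_ = _+ᵥ_ ; ε = 0ᵥ }

  -- Membership is decidable, as it is classically for any subset of the
  -- finite set V.
  record Subspace : Set₁ where
    field
      carrier    : Pred V 0ℓ
      decidable  : Decidable carrier
      0ᵥ∈        : 0ᵥ ∈ₛ carrier
      +ᵥ-closed  : ∀ {u v} → u ∈ₛ carrier → v ∈ₛ carrier → (u +ᵥ v) ∈ₛ carrier
      ·ₖ-closed  : ∀ a {v} → v ∈ₛ carrier → (a ·ₖ v) ∈ₛ carrier
  open Subspace public using (carrier)

  combination : ∀ {r} → Vector K.Carrier r → Vector V r → V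
  combination a b = RawMonoidOps.sum +ᵥ-rawMonoid (λ i → a i ·ₖ b i)

  record IsBasis (U : Subspace) {r : ℕ} (b : Vector V r) : Set where
    field
      members     : ∀ i → b i ∈ₛ carrier U
      independent : ∀ a → combination a b ≡ 0ᵥ → ∀ i → a i ≡ K.0#
      spanning    : ∀ {v} → v ∈ₛ carrier U → ∃[ a ] combination a b ≡ v

  HasDimension : Subspace → ℕ → Set
  HasDimension U r = ∃[ b ] IsBasis U {r} b

  ⟨_⟩ : V → Pred V 0ℓ
  ⟨ v ⟩ w = ∃[ x ] w ≡ x · v

  -- A nonzero vector stands for the point it spans; as there are no
  -- quotients, equality of points is the relation _≈ₚ_.
  Point : Set
  Point = Σ V (_≢ 0ᵥ)

  _≈ₚ_ : Point → Point → Set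
  P ≈ₚ Q = ⟨ proj₁ P ⟩ ≐ ⟨ proj₁ Q ⟩

  -- L_U, for U given by its underlying set.
  LinearSet : Pred V 0ℓ → Pred Point 0ℓ
  LinearSet U P = Σ Point λ Q → proj₁ Q ∈ₛ U × Q ≈ₚ P

  record HasCardinality (L : Pred Point 0ℓ) (n : ℕ) : Set where
    field
      point    : Fin n → Point
      members  : ∀ i → point i ∈ₛ L
      distinct : ∀ i j → point i ≈ₚ point j → i ≡ j
      covering : ∀ P → P ∈ₛ L → ∃[ i ] point i ≈ₚ P

  -- U has 𝔽_q-dimension r and #L_U = (q^r - 1)/(q - 1).
  IsScatteredOfRank : Subspace → ℕ → Set
  IsScatteredOfRank U r =
    HasDimension U r ×
    (∃[ n ] (HasCardinality (LinearSet (carrier U)) n × n ℕ.* (q ∸ 1) ≡ q ℕ.^ r ∸ 1))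

  record IsSemilinear (σ : F → F) (κ : V → V) : Set where
    field
      +-homo : ∀ u v → κ (u +ᵥ v) ≡ κ u +ᵥ κ v
      ·-homo : ∀ x v → κ (x · v) ≡ σ x · κ v

  record ΓL : Set where
    field
      σ            : F → F
      κ            : V → V
      automorphism : IsRingIsomorphism rawRing rawRing σ
      semilinear   : IsSemilinear σ κ
      bijective    : Bijective _≡_ _≡_ κ

  record GL : Set where
    field
      κ         : V → V
      linear    : IsSemilinear id κ
      bijective : Bijective _≡_ _≡_ κ

  -- The projectivity of PG(1,q^t) induced by an element of GL(2,q^t).
  projectivity : GL → Point → Point
  projectivity g (v , v≢0) = κ v , λ κv≡0 → v≢0 (proj₁ bijective (trans κv≡0 (sym κ0≡0)))
    where
      open GL g
      0·≡0 : ∀ w → 0# · w ≡ 0ᵥ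
      0·≡0 (a , b) rewrite zeroˡ a | zeroˡ b = refl
      κ0≡0 : κ 0ᵥ ≡ 0ᵥ
      κ0≡0 = trans (cong κ (sym (0·≡0 0ᵥ)))
                   (trans (IsSemilinear.·-homo linear 0# 0ᵥ) (0·≡0 (κ 0ᵥ)))

  imageₚ : (Point → Point) → Pred Point 0ℓ → Pred Point 0ℓ
  imageₚ φ L Q = ∃[ P ] (P ∈ₛ L × φ P ≈ₚ Q)

  ΓL-Equivalent : Subspace → Subspace → Set
  ΓL-Equivalent U U′ = Σ ΓL λ g → carrier U ≐ image (ΓL.κ g) (carrier U′)

  HasInequivalentSubspaces : Pred Point 0ℓ → ℕ → Set₁
  HasInequivalentSubspaces L c = Σ (Fin c → Subspace) λ U →
      (∀ i → LinearSet (carrier (U i)) ≐ L)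
    × (∀ i j → i ≢ j → ¬ ΓL-Equivalent (U i) (U j))

  -- c = c_Γ(L), specified by its defining property.
  IsΓLClass : Pred Point 0ℓ → ℕ → Set₁
  IsΓLClass L c =
    HasInequivalentSubspaces L c × (∀ d → HasInequivalentSubspaces L d → d ≤ c)

  -- Σ_{i=0}^k a_i x^{q^i}
  record LinearizedPolynomial : Set where
    field
      k    : ℕ
      coef : Vector F (suc k)

    eval : F → F
    eval x = RawMonoidOps.sum +-rawMonoid (λ i → coef i * x ^ (q ℕ.^ toℕ i))
  open LinearizedPolynomial public using (eval)

  LinearlyDependent : F → F → Set
  LinearlyDependent y z =
    ∃₂ λ a b → ¬ (a ≡ K.0# × b ≡ K.0#) × ι a * y + ι b * z ≡ 0#

  IsScatteredPolynomial : LinearizedPolynomial → Set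
  IsScatteredPolynomial f =
    ∀ y z → z * eval f y - y * eval f z ≡ 0# → LinearlyDependent y z

  -- U_f = {(x , f(x))}
  graph : LinearizedPolynomial → Pred V 0ℓ
  graph f v = ∃[ x ] v ≡ (x , eval f x)

  -- L_f = {f(x)/x : x ≠ 0}
  Slopes : LinearizedPolynomial → Pred F 0ℓ
  Slopes f m = ∃[ x ] (x ≢ 0# × m ≡ eval f x * x ⁻¹)

  -- 𝒜(ℬ) for a family of subsets of V: points are vectors and lines are
  -- the cosets S + w with S in the family.
  translationPlane : {I : Set} → (I → Pred V 0ℓ) → IncidenceStructure
  translationPlane {I} ℬ = record
    { Point = V
    ; Line  = I × V
    ; _on_  = λ { v (i , w) → ∃[ u ] (u ∈ₛ ℬ i × v ≡ u +ᵥ w) }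
    }

  -- Indices of the members of ℬ_f. Distinct indices may name the same
  -- member: h U_f depends only on h modulo 𝔽_q^*.
  data SpreadIndex (f : LinearizedPolynomial) : Set where
    slope    : (m : F) → m ∉ₛ Slopes f → SpreadIndex f
    multiple : (h : F) → h ≢ 0# → SpreadIndex f
    vertical : SpreadIndex f

  spread : (f : LinearizedPolynomial) → SpreadIndex f → Pred V 0ℓ
  spread f (slope m _)    = ⟨ 1# , m ⟩
  spread f (multiple h _) = image (h ·_) (graph f)
  spread f vertical       = λ v → proj₁ v ≡ 0#

  𝒜 : LinearizedPolynomial → IncidenceStructure
  𝒜 f = translationPlane (spread f)

{-# OPTIONS --safe #-}

-- Choose a point outside L and move it to ⟨(0 , 1)⟩: every subspace U with
-- L_U = L becomes the graph of an 𝔽_q-linear map, which Newton interpolation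
-- writes as a linearized polynomial. Let φ be an isomorphism between two such
-- planes with φ(0) = 0. Since φ preserves parallelism, it is additive and maps
-- spread elements to spread elements. A slope m is bad if m ∈ L_f or if
-- ⟨(1 , m)⟩ is mapped to some h U_g; as L has N = (q^t - 1)/(q - 1) points,
-- there are at most 2N bad slopes, hence, because q > 3, more than N good
-- ones, whose lines are mapped to 𝔽_{q^t}-lines. That many lines force φ to be
-- semilinear: its coordinate map is multiplicative at N elements and N² > q^t.
-- As t > 1, U_f is not an 𝔽_{q^t}-line, so it is mapped to some h U_g, and
-- h⁻¹φ shows that the subspaces are ΓL-equivalent.
module Submission where

open import Defs
open import Level using (0ℓ)
open import Algebra.Bundles using (CommutativeRing; CommutativeMonoid)
open import Algebra.Morphism.Structures using (IsRingHomomorphism; IsRingIsomorphism)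
import Algebra.Properties.AbelianGroup as AbelianGroupProperties
import Algebra.Properties.CommutativeMonoid.Sum as Sum
import Algebra.Properties.CommutativeSemiring.Binomial as Binomial
import Algebra.Properties.CommutativeSemiring.Exp as Exp
import Algebra.Properties.Ring as RingProperties
import Algebra.Properties.Semiring.Mult as Mult
import Algebra.Properties.Semiring.Mult.TCOptimised as SemiringMult
import Algebra.Solver.Ring
open import Algebra.Solver.Ring.AlmostCommutativeRing using (fromCommutativeRing; _-Raw-AlmostCommutative⟶_)
open import Data.Bool using (if_then_else_)
open import Data.Fin as Fin using (Fin; zero; suc; toℕ; fromℕ; inject₁; inject≤; punchIn; remQuot; combine)
open import Data.Fin.Permutation using (Permutation)
open import Data.Fin.Properties as Finₚ using (any?; injective⇒≤; pigeonhole; ¬∀⟶∃¬; toℕ-fromℕ; toℕ-inject₁; toℕ<n; punchInᵢ≢i; punchIn-injective; combine-remQuot; combine-injective; suc-injective; <⇒≢; inject≤-injective)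
open import Data.Integer as ℤ using (ℤ; -[1+_]) renaming (+_ to pos)
import Data.Integer.Properties as ℤₚ
open import Data.List using (List; []; _∷_; map; tabulate)
open import Data.List.Membership.Propositional using (_∈_)
open import Data.List.Membership.Propositional.Properties using (∈-tabulate⁺)
open import Data.List.Relation.Unary.Any using (here; there)
open import Data.Maybe as Maybe using (Maybe)
open import Data.Nat as ℕ using (ℕ; zero; suc; _<_; _≤_; _!; _∸_; s≤s; z≤n)
open import Data.Nat.Combinatorics using (_C_; nCn≡1; nCk≡nC[n∸k]; k![n∸k]!∣n!)
open import Data.Nat.Combinatorics.Specification using (nCk≡n!/k![n-k]!)
open import Data.Nat.Divisibility using (_∣_; divides; m∣m*n; ∣⇒≤; ∣1⇒≡1)
open import Data.Nat.DivMod using (m/n*n≡m)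
open import Data.Nat.Primality using (Prime; euclidsLemma; ¬prime[1]; ¬prime[0])
open import Data.Nat.Properties using (_!*_!≢0)
import Data.Nat.Properties as ℕₚ
open import Data.Product using (Σ; ∃; ∃₂; ∃-syntax; _×_; _,_; proj₁; proj₂)
open import Data.Sum using (_⊎_; inj₁; inj₂; [_,_]′)
open import Data.Vec.Functional using (Vector; init; replicate; removeAt)
open import Function.Base using (_∘_; id; const)
open import Function.Bundles using (_↔_; Inverse; mk↔ₛ′)
open import Function.Definitions using (Injective)
open import Relation.Nullary using (¬_; Dec; yes; no; does; contradiction)
open import Relation.Nullary.Decidable using (decidable-stable; dec⇒maybe; map′; ¬?; _×-dec_)
open import Relation.Unary using (Pred; Decidable; _≐_)
open import Relation.Unary.Properties using (≐-sym; ≐-trans)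
open import Relation.Binary.PropositionalEquality using (_≡_; _≢_; refl; sym; trans; cong; cong₂; subst; module ≡-Reasoning)

-- The obstacle is that an isomorphism only sees the spreads, and ℬ_f mixes 𝔽_{q^t}-lines with the
-- subspaces h U_f, which are merely 𝔽_q-linear; nothing forbids at the outset that φ exchanges the
-- two kinds. Counting rules this out for enough lines. Both bounds come from one fact: the q^t - 1
-- = N(q - 1) nonzero scalars fall into N classes modulo 𝔽_q^*. A slope f(x)/x depends only on the
-- class of x, a subspace h U_g only on that of h, so each source of bad slopes contributes at most
-- N; and q > 3 enters as 3N + 1 ≤ N(q - 1) + 1 = q^t, which leaves N + 1 good slopes: one serves as
-- infinity and N as affine parameters. The subspaces with L_U = L come without a prescribed rank.
-- The projection from the chosen point is injective on each of them, and its values at the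
-- 𝔽_q-multiples of one vector over each point of L already number q^t. Hence it is bijective, which
-- gives the linear map, its scatteredness and the N classes together. The point depends on L alone,
-- so the same κ serves all c subspaces.

-- A ring solver with integer coefficients

-- The stdlib instances of the ring solver take their coefficients in R itself,
-- where cancellation x - x = 0 is not computable; ℤ repairs this.
module IntegerCoefficients {r ℓ} (R : CommutativeRing r ℓ) where
  open CommutativeRing R renaming (sym to ≈-sym; trans to ≈-trans; refl to ≈-refl)
  open RingProperties ring using (-0#≈0#; -‿distribˡ-*; -‿distribʳ-*; -‿involutive)
  open AbelianGroupProperties +-abelianGroup using (⁻¹-∙-comm)
  open SemiringMult semiring using (×1-homo-*; ×-homo-+; 1+×) renaming (_×_ to _×ⁿ_)
  open import Relation.Binary.Reasoning.Setoid setoid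

  -- With this version of the multiple, `⟦ pos 1 ⟧` reduces to `1#` without a trailing summand, so
  -- the solver constants `:0` and `:1` denote `0#` and `1#` definitionally.
  ⟦_⟧ : ℤ → Carrier
  ⟦ pos n ⟧      = n ×ⁿ 1#
  ⟦ -[1+ n ] ⟧ = - (suc n ×ⁿ 1#)

  ⟦⟧-⊖ : ∀ m n → ⟦ m ℤ.⊖ n ⟧ ≈ m ×ⁿ 1# + - (n ×ⁿ 1#)
  ⟦⟧-⊖ zero    zero    = ≈-sym (-‿inverseʳ 0#)
  ⟦⟧-⊖ zero    (suc n) = ≈-sym (+-identityˡ _)
  ⟦⟧-⊖ (suc m) zero    = ≈-sym (≈-trans (+-congˡ -0#≈0#) (+-identityʳ _))
  ⟦⟧-⊖ (suc m) (suc n) = begin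
    ⟦ suc m ℤ.⊖ suc n ⟧                        ≡⟨ cong ⟦_⟧ (ℤₚ.[1+m]⊖[1+n]≡m⊖n m n) ⟩
    ⟦ m ℤ.⊖ n ⟧                                ≈⟨ ⟦⟧-⊖ m n ⟩
    a + - b                                    ≈⟨ +-congʳ (+-identityʳ a) ⟨
    (a + 0#) + - b                             ≈⟨ +-congʳ (+-congˡ (-‿inverseʳ 1#)) ⟨
    (a + (1# + - 1#)) + - b                    ≈⟨ +-congʳ (+-assoc _ _ _) ⟨
    ((a + 1#) + - 1#) + - b                    ≈⟨ +-assoc _ _ _ ⟩
    (a + 1#) + (- 1# + - b)                    ≈⟨ +-cong (+-comm _ _) (⁻¹-∙-comm _ _) ⟩
    (1# + a) + - (1# + b)                      ≈⟨ +-cong (1+× m 1#) (-‿cong (1+× n 1#)) ⟨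
    suc m ×ⁿ 1# + - (suc n ×ⁿ 1#)                ∎
    where
    a = m ×ⁿ 1#
    b = n ×ⁿ 1#

  +-homo : ∀ i j → ⟦ i ℤ.+ j ⟧ ≈ ⟦ i ⟧ + ⟦ j ⟧
  +-homo (pos m)    (pos n)    = ×-homo-+ 1# m n
  +-homo (pos m)    -[1+ n ] = ⟦⟧-⊖ m (suc n)
  +-homo -[1+ m ] (pos n)    = ≈-trans (⟦⟧-⊖ n (suc m)) (+-comm _ _)
  +-homo -[1+ m ] -[1+ n ] = begin
    - (suc (suc (m ℕ.+ n)) ×ⁿ 1#)             ≡⟨ cong (λ k → - (suc k ×ⁿ 1#)) (ℕₚ.+-suc m n) ⟨
    - ((suc m ℕ.+ suc n) ×ⁿ 1#)               ≈⟨ -‿cong (×-homo-+ 1# (suc m) (suc n)) ⟩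
    - (suc m ×ⁿ 1# + suc n ×ⁿ 1#)            ≈⟨ ⁻¹-∙-comm _ _ ⟨
    - (suc m ×ⁿ 1#) + - (suc n ×ⁿ 1#)          ∎

  -‿homo : ∀ i → ⟦ ℤ.- i ⟧ ≈ - ⟦ i ⟧
  -‿homo (pos zero)  = ≈-sym -0#≈0#
  -‿homo (pos (suc n)) = ≈-refl
  -‿homo -[1+ n ]  = ≈-sym (-‿involutive _)

  *-homo-+ : ∀ m i → ⟦ pos m ℤ.* i ⟧ ≈ m ×ⁿ 1# * ⟦ i ⟧
  *-homo-+ m (pos n) = begin
    ⟦ pos m ℤ.* pos n ⟧     ≡⟨ cong ⟦_⟧ (ℤₚ.pos-* m n) ⟨
    (m ℕ.* n) ×ⁿ 1#      ≈⟨ ×1-homo-* m n ⟩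
    m ×ⁿ 1# * (n ×ⁿ 1#)   ∎
  *-homo-+ m -[1+ n ] = begin
    ⟦ pos m ℤ.* ℤ.- (pos (suc n)) ⟧   ≡⟨ cong ⟦_⟧ (ℤₚ.neg-distribʳ-* (pos m) (pos (suc n))) ⟨
    ⟦ ℤ.- (pos m ℤ.* pos (suc n)) ⟧   ≈⟨ -‿homo (pos m ℤ.* pos (suc n)) ⟩
    - ⟦ pos m ℤ.* pos (suc n) ⟧       ≈⟨ -‿cong (*-homo-+ m (pos (suc n))) ⟩
    - (m ×ⁿ 1# * (suc n ×ⁿ 1#))   ≈⟨ -‿distribʳ-* _ _ ⟩
    m ×ⁿ 1# * - (suc n ×ⁿ 1#)     ∎

  *-homo : ∀ i j → ⟦ i ℤ.* j ⟧ ≈ ⟦ i ⟧ * ⟦ j ⟧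
  *-homo (pos m)    j = *-homo-+ m j
  *-homo -[1+ m ] j = begin
    ⟦ ℤ.- (pos (suc m)) ℤ.* j ⟧     ≡⟨ cong ⟦_⟧ (ℤₚ.neg-distribˡ-* (pos (suc m)) j) ⟨
    ⟦ ℤ.- (pos (suc m) ℤ.* j) ⟧     ≈⟨ -‿homo (pos (suc m) ℤ.* j) ⟩
    - ⟦ pos (suc m) ℤ.* j ⟧         ≈⟨ -‿cong (*-homo-+ (suc m) j) ⟩
    - (suc m ×ⁿ 1# * ⟦ j ⟧)      ≈⟨ -‿distribˡ-* _ _ ⟩
    - (suc m ×ⁿ 1#) * ⟦ j ⟧      ∎

  morphism : ℤ.+-*-rawRing -Raw-AlmostCommutative⟶ fromCommutativeRing R
  morphism = record
    { ⟦_⟧ = ⟦_⟧ ; +-homo = +-homo ; *-homo = *-homo ; -‿homo = -‿homo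
    ; 0-homo = ≈-refl ; 1-homo = ≈-refl }

  coefficient≟ : ∀ i j → Maybe (⟦ i ⟧ ≈ ⟦ j ⟧)
  coefficient≟ i j = Maybe.map (λ i≡j → reflexive (cong ⟦_⟧ i≡j)) (dec⇒maybe (i ℤ.≟ j))

  open Algebra.Solver.Ring ℤ.+-*-rawRing (fromCommutativeRing R) morphism coefficient≟ public
    using (Polynomial; solve; con; _:=_; _:+_; _:*_; _:-_; :-_)

  :0 :1 : ∀ {n} → Polynomial n
  :0 = con (pos 0)
  :1 = con (pos 1)

-- Finite sets and prime divisors of binomial coefficients

injective⇒surjective : ∀ {n} {f : Fin n → Fin n} → Injective _≡_ _≡_ f → ∀ y → ∃[ x ] f x ≡ y
injective⇒surjective {n} {f} f-inj y = decidable-stable (any? λ x → f x Finₚ.≟ y) λ missed →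
  let g : Fin (suc n) → Fin n
      g = λ { zero → y ; (suc x) → f x }
      g-inj : Injective _≡_ _≡_ g
      g-inj = λ { {zero} {zero} _ → refl ; {zero} {suc x} y≡fx → contradiction (x , sym y≡fx) missed
                ; {suc x} {zero} fx≡y → contradiction (x , fx≡y) missed ; {suc x} {suc x′} eq → cong suc (f-inj eq) }
  in ℕₚ.1+n≰n (injective⇒≤ g-inj)

<⇒omits : ∀ {m n} → m < n → (f : Fin m → Fin n) → ∃[ y ] (∀ x → f x ≢ y)
<⇒omits {m} {n} m<n f with ¬∀⟶∃¬ n (λ y → ∃[ x ] f x ≡ y) (λ y → any? λ x → f x Finₚ.≟ y) ¬surjective
  where
  ¬surjective : ¬ (∀ y → ∃[ x ] f x ≡ y)
  ¬surjective f⁻¹ = ℕₚ.<⇒≱ m<n (injective⇒≤ {f = proj₁ ∘ f⁻¹} λ {y} {y′} eq →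
    trans (sym (proj₂ (f⁻¹ y))) (trans (cong f eq) (proj₂ (f⁻¹ y′))))
... | y , y∉f = y , λ x fx≡y → y∉f (x , fx≡y)

prime∤! : ∀ {p} → Prime p → ∀ k → k < p → ¬ p ∣ k !
prime∤! p-prime zero    k<p p∣1 = ¬prime[1] (subst Prime (∣1⇒≡1 p∣1) p-prime)
prime∤! p-prime (suc k) k<p p∣k! with euclidsLemma (suc k) (k !) p-prime p∣k!
... | inj₁ p∣1+k = ℕₚ.<⇒≱ k<p (∣⇒≤ p∣1+k)
... | inj₂ p∣k!′ = prime∤! p-prime k (ℕₚ.<-trans (ℕₚ.n<1+n k) k<p) p∣k!′

-- p divides p! = C(p,k) · k! (p - k)!, but neither factorial, as both arguments are smaller than p.
prime∣C : ∀ {p} → Prime p → ∀ k → 0 < k → k < p → p ∣ p C k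
prime∣C {zero}    p-prime k 0<k k<p = contradiction p-prime ¬prime[0]
prime∣C {p@(suc p-1)} p-prime k 0<k k<p = [ id , (λ p∣k![p-k]! → contradiction p∣k![p-k]! p∤k![p-k]!) ]′
    (euclidsLemma (p C k) (k ! ℕ.* (p ∸ k) !) p-prime (subst (p ∣_) p!≡ (m∣m*n (p-1 !))))
  where
  instance _ = k !* (p ∸ k) !≢0
  p!≡ : p ! ≡ (p C k) ℕ.* (k ! ℕ.* (p ∸ k) !)
  p!≡ = sym (trans (cong (ℕ._* (k ! ℕ.* (p ∸ k) !)) (nCk≡n!/k![n-k]! (ℕₚ.<⇒≤ k<p)))
                   (m/n*n≡m (k![n∸k]!∣n! (ℕₚ.<⇒≤ k<p))))
  p∤k![p-k]! : ¬ p ∣ k ! ℕ.* (p ∸ k) !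
  p∤k![p-k]! p∣ with euclidsLemma (k !) ((p ∸ k) !) p-prime p∣
  ... | inj₁ p∣k!     = prime∤! p-prime k k<p p∣k!
  ... | inj₂ p∣[p-k]! = prime∤! p-prime (p ∸ k) (ℕₚ.∸-monoʳ-< 0<k (ℕₚ.<⇒≤ k<p)) p∣[p-k]!

-- A form of `punchIn` for an n that is not syntactically a successor, such as the order of a field.
skip : ∀ {n} → Fin n → Fin (n ∸ 1) → Fin n
skip {suc n} = punchIn

skip-injective : ∀ {n} (i : Fin n) → Injective _≡_ _≡_ (skip i)
skip-injective {suc n} i = punchIn-injective i _ _

skip≢ : ∀ {n} (i : Fin n) j → skip i j ≢ i
skip≢ {suc n} i j = punchInᵢ≢i i j

-- Finite fields

module FieldTheory {n : ℕ} (𝔽 : FiniteField n) where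
  open FiniteField 𝔽 public
  open CommutativeRing commutativeRing public
    using (+-identityˡ; +-identityʳ; *-identityˡ; *-identityʳ; zeroʳ; +-assoc; +-comm; *-assoc; *-comm; distribˡ; distribʳ;
           -‿inverseʳ; -‿inverseˡ; commutativeSemiring; semiring; +-commutativeMonoid; *-commutativeMonoid)
  open IntegerCoefficients commutativeRing public using (solve; :0; :1; _:=_; _:+_; _:*_; _:-_; :-_)
  open Exp commutativeSemiring public using (_^_; ^-assocʳ; ^-distrib-*)
  open Mult semiring public using (×1-homo-*; ×-homo-1; ×-assoc-*) renaming (_×_ to _×ⁿ_)
  open Sum *-commutativeMonoid using ()
    renaming (sum to product; sum-remove to product-remove; sum-replicate to product-replicate; sum-cong-≗ to product-cong; ∑-distrib-+ to ∏-distrib-*)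
  open ≡-Reasoning

  index : Carrier → Fin n
  index = Inverse.to enumeration

  element : Fin n → Carrier
  element = Inverse.from enumeration

  element-index : ∀ x → element (index x) ≡ x
  element-index = Inverse.strictlyInverseʳ enumeration

  index-element : ∀ i → index (element i) ≡ i
  index-element = Inverse.strictlyInverseˡ enumeration

  index-injective : Injective _≡_ _≡_ index
  index-injective {x} {y} eq = trans (sym (element-index x)) (trans (cong element eq) (element-index y))

  element-injective : Injective _≡_ _≡_ element
  element-injective {i} {j} eq = trans (sym (index-element i)) (trans (cong index eq) (index-element j))

  infix 4 _≟_
  _≟_ : ∀ (x y : Carrier) → Dec (x ≡ y)
  x ≟ y with index x Finₚ.≟ index y
  ... | yes eq = yes (index-injective eq)
  ... | no neq = no (neq ∘ cong index)

  ∃? : ∀ {P : Pred Carrier 0ℓ} → Decidable P → Dec (∃ P)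
  ∃? {P} P? = map′ (λ (i , p) → element i , p) (λ (x , p) → index x , subst P (sym (element-index x)) p)
                   (any? λ i → P? (element i))

  injective⇒onto : ∀ {m} → m ≡ n → {f : Fin m → Carrier} → Injective _≡_ _≡_ f → ∀ y → ∃[ i ] f i ≡ y
  injective⇒onto refl {f} f-inj y =
    let i , eq = injective⇒surjective {f = index ∘ f} (f-inj ∘ index-injective) (index y)
    in i , index-injective eq

  endo-injective⇒onto : {f : Carrier → Carrier} → Injective _≡_ _≡_ f → ∀ y → ∃[ x ] f x ≡ y
  endo-injective⇒onto {f} f-inj y =
    let i , eq = injective⇒onto refl {f = f ∘ element} (element-injective ∘ f-inj) y
    in element i , eq

  1≢0 : 1# ≢ 0#
  1≢0 = 0≢1 ∘ sym

  *-inverseˡ : ∀ {x} → x ≢ 0# → x ⁻¹ * x ≡ 1#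
  *-inverseˡ {x} x≢0 = trans (*-comm (x ⁻¹) x) (*-inverseʳ x x≢0)

  *-cancelˡ : ∀ {c x y} → c ≢ 0# → c * x ≡ c * y → x ≡ y
  *-cancelˡ {c} {x} {y} c≢0 cx≡cy = begin
    x               ≡⟨ lemma x ⟨
    c ⁻¹ * (c * x)  ≡⟨ cong (c ⁻¹ *_) cx≡cy ⟩
    c ⁻¹ * (c * y)  ≡⟨ lemma y ⟩
    y               ∎
    where
    lemma : ∀ z → c ⁻¹ * (c * z) ≡ z
    lemma z = trans (sym (*-assoc _ _ _)) (trans (cong (_* z) (*-inverseˡ c≢0)) (*-identityˡ z))

  *-cancelʳ : ∀ {c x y} → c ≢ 0# → x * c ≡ y * c → x ≡ y
  *-cancelʳ {c} {x} {y} c≢0 eq = *-cancelˡ c≢0 (trans (*-comm c x) (trans eq (*-comm y c)))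

  nonzero-* : ∀ {x y} → x ≢ 0# → y ≢ 0# → x * y ≢ 0#
  nonzero-* {x} x≢0 y≢0 xy≡0 = y≢0 (*-cancelˡ x≢0 (trans xy≡0 (sym (zeroʳ x))))

  nonzero-*ˡ : ∀ {x y} → x * y ≢ 0# → x ≢ 0#
  nonzero-*ˡ {y = y} xy≢0 x≡0 = xy≢0 (trans (cong (_* y) x≡0) (zeroˡ y))

  nonzero-⁻¹ : ∀ {x} → x ≢ 0# → x ⁻¹ ≢ 0#
  nonzero-⁻¹ {x} x≢0 x⁻¹≡0 = 1≢0 (trans (sym (*-inverseʳ x x≢0)) (trans (cong (x *_) x⁻¹≡0) (zeroʳ x)))

  x-y≡0⇒x≡y : ∀ {x y} → x - y ≡ 0# → x ≡ y
  x-y≡0⇒x≡y {x} {y} eq = begin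
    x            ≡⟨ solve 2 (λ x y → x := (x :- y) :+ y) refl x y ⟩
    (x - y) + y  ≡⟨ cong (_+ y) eq ⟩
    0# + y       ≡⟨ +-identityˡ y ⟩
    y            ∎

  x≡y⇒x-y≡0 : ∀ {x y} → x ≡ y → x - y ≡ 0#
  x≡y⇒x-y≡0 {x} refl = -‿inverseʳ x

  nonzero-difference : ∀ {x y} → x ≢ y → x - y ≢ 0#
  nonzero-difference x≢y = x≢y ∘ x-y≡0⇒x≡y

  +-cancelʳ : ∀ {c x y} → x + c ≡ y + c → x ≡ y
  +-cancelʳ {c} {x} {y} eq = x-y≡0⇒x≡y (begin
    x - y              ≡⟨ solve 3 (λ x y c → x :- y := (x :+ c) :- (y :+ c)) refl x y c ⟩
    (x + c) - (y + c)  ≡⟨ x≡y⇒x-y≡0 eq ⟩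
    0#                 ∎)

  x⁻¹*[x*y]≡y : ∀ {x} → x ≢ 0# → ∀ y → x ⁻¹ * (x * y) ≡ y
  x⁻¹*[x*y]≡y {x} x≢0 y = trans (sym (*-assoc _ _ _)) (trans (cong (_* y) (*-inverseˡ x≢0)) (*-identityˡ y))

  x*[x⁻¹*y]≡y : ∀ {x} → x ≢ 0# → ∀ y → x * (x ⁻¹ * y) ≡ y
  x*[x⁻¹*y]≡y {x} x≢0 y = trans (sym (*-assoc _ _ _)) (trans (cong (_* y) (*-inverseʳ x x≢0)) (*-identityˡ y))

  ^-nonzero : ∀ {x} → x ≢ 0# → ∀ k → x ^ k ≢ 0#
  ^-nonzero x≢0 zero    = 1≢0
  ^-nonzero x≢0 (suc k) = nonzero-* x≢0 (^-nonzero x≢0 k)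

  ^-zero⇒ : ∀ {x} k → x ^ k ≡ 0# → x ≡ 0#
  ^-zero⇒ {x} k eq = decidable-stable (x ≟ 0#) λ x≢0 → ^-nonzero x≢0 k eq

  module _ (M : CommutativeMonoid 0ℓ 0ℓ) where
    private module M = CommutativeMonoid M
    open Sum M using (sum; sum-permute)
    -- Needed for both operations: translation by 1 permutes the summands, scaling by x ≠ 0 the
    -- factors.
    sum-reindex : (π : Carrier ↔ Carrier) (h : Carrier → M.Carrier) →
                  sum (h ∘ element) M.≈ sum (h ∘ Inverse.to π ∘ element)
    sum-reindex π h = M.trans (sum-permute (h ∘ element) ρ) (M.reflexive (Sum.sum-cong-≗ M {n} λ i → cong h (element-index (Inverse.to π (element i)))))
      where
      ρ : Permutation n n
      ρ = mk↔ₛ′ (index ∘ Inverse.to π ∘ element) (index ∘ Inverse.from π ∘ element)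
        (λ i → trans (cong (index ∘ Inverse.to π) (element-index _)) (trans (cong index (Inverse.strictlyInverseˡ π _)) (index-element i)))
        (λ i → trans (cong (index ∘ Inverse.from π) (element-index _)) (trans (cong index (Inverse.strictlyInverseʳ π _)) (index-element i)))

  -- Translation by 1 permutes the field, so adding 1 to each of the n summands leaves the sum of
  -- all elements unchanged.
  n×1≡0 : n ×ⁿ 1# ≡ 0#
  n×1≡0 = +-cancelʳ (begin
    n ×ⁿ 1# + sum element               ≡⟨ cong (_+ sum element) (sum-replicate n) ⟨
    sum (replicate n 1#) + sum element  ≡⟨ ∑-distrib-+ (replicate n 1#) element ⟨
    sum (λ i → 1# + element i)          ≡⟨ sum-reindex +-commutativeMonoid shift id ⟨
    sum element                         ≡⟨ +-identityˡ _ ⟨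
    0# + sum element                    ∎)
    where
    open Sum +-commutativeMonoid using (sum; sum-replicate; ∑-distrib-+)
    shift : Carrier ↔ Carrier
    shift = mk↔ₛ′ (1# +_) (_- 1#)
      (λ x → solve 1 (λ x → :1 :+ (x :- :1) := x) refl x)
      (λ x → solve 1 (λ x → (:1 :+ x) :- :1 := x) refl x)

  ×1-^ : ∀ m k → (m ℕ.^ k) ×ⁿ 1# ≡ (m ×ⁿ 1#) ^ k
  ×1-^ m zero    = ×-homo-1 1#
  ×1-^ m (suc k) = trans (×1-homo-* m (m ℕ.^ k)) (cong (m ×ⁿ 1# *_) (×1-^ m k))

  -- (p · 1)^k = p^k · 1 = 0, and a field has no nilpotent elements except 0.
  characteristic : ∀ {p k} → n ≡ p ℕ.^ k → p ×ⁿ 1# ≡ 0#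
  characteristic {p} {k} refl = ^-zero⇒ k (trans (sym (×1-^ p k)) n×1≡0)

  -- The product is `t i` times x to the power m - 1; the extra factor x on both sides avoids the
  -- predecessor.
  product-const-off : ∀ {m} x (t : Vector Carrier m) i → (∀ j → j ≢ i → t j ≡ x) → t i * x ^ m ≡ x * product t
  product-const-off {suc m} x t i t≡x = begin
    t i * (x * x ^ m)                          ≡⟨ solve 3 (λ a x y → a :* (x :* y) := x :* (a :* y)) refl (t i) x (x ^ m) ⟩
    x * (t i * x ^ m)                          ≡⟨ cong (λ z → x * (t i * z)) (product-replicate m) ⟨
    x * (t i * product (replicate m x))        ≡⟨ cong (λ z → x * (t i * z)) (product-cong (λ j → t≡x (punchIn i j) (punchInᵢ≢i i j))) ⟨
    x * (t i * product (removeAt t i))         ≡⟨ cong (x *_) (product-remove t) ⟨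
    x * product t                              ∎

  product-nonzero : ∀ {m} (t : Vector Carrier m) → (∀ i → t i ≢ 0#) → product t ≢ 0#
  product-nonzero {zero}  t t≢0 = 1≢0
  product-nonzero {suc m} t t≢0 = nonzero-* (t≢0 zero) (product-nonzero (t ∘ suc) (t≢0 ∘ suc))

  -- Multiplication by x ≠ 0 permutes the nonzero elements, so x^(n-1) leaves
  -- their product unchanged; 0 is kept as an index, with the factor 1.
  fermat : ∀ x → x ^ n ≡ x
  fermat x with x ≟ 0#
  ... | yes refl = 0^n≡0 (index 0#)
    where
    0^n≡0 : ∀ {m} → Fin m → 0# ^ m ≡ 0#
    0^n≡0 {suc m} _ = zeroˡ _
  ... | no x≢0 = begin
    x ^ n                    ≡⟨ *-identityˡ _ ⟨
    1# * x ^ n               ≡⟨ cong (_* x ^ n) (trans (cong (at-nonzero x) (element-index 0#)) (at-0 x)) ⟨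
    at-nonzero x (element (index 0#)) * x ^ n
      ≡⟨ product-const-off x (at-nonzero x ∘ element) (index 0#) (λ j j≢ → at-≢0 x λ eq → j≢ (trans (sym (index-element j)) (cong index eq))) ⟩
    x * product (at-nonzero x ∘ element)    ≡⟨ cong (x *_) (*-cancelʳ Πelements≢0 (trans Π≡Π (sym (*-identityˡ _)))) ⟩
    x * 1#                   ≡⟨ *-comm x 1# ⟩
    1# * x                   ≡⟨ *-identityˡ x ⟩
    x                        ∎
    where
    at-nonzero : Carrier → Carrier → Carrier
    at-nonzero z y = if does (y ≟ 0#) then 1# else z

    at-0 : ∀ z → at-nonzero z 0# ≡ 1#
    at-0 z with 0# ≟ 0#
    ... | yes _  = refl
    ... | no 0≢0 = contradiction refl 0≢0

    at-≢0 : ∀ z {y} → y ≢ 0# → at-nonzero z y ≡ z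
    at-≢0 z {y} y≢0 with y ≟ 0#
    ... | yes y≡0 = contradiction y≡0 y≢0
    ... | no _    = refl

    h : Carrier → Carrier
    h y = at-nonzero y y

    h-shift : ∀ y → at-nonzero x y * h y ≡ h (x * y)
    h-shift y with y ≟ 0#
    ... | yes refl = trans (*-identityˡ 1#) (sym (trans (cong h (zeroʳ x)) (at-0 0#)))
    ... | no y≢0   = sym (at-≢0 (x * y) (nonzero-* x≢0 y≢0))

    h≢0 : ∀ y → h y ≢ 0#
    h≢0 y with y ≟ 0#
    ... | yes _   = 1≢0
    ... | no y≢0  = y≢0

    Πelements≢0 : product (h ∘ element) ≢ 0#
    Πelements≢0 = product-nonzero _ (λ i → h≢0 (element i))

    scale : Carrier ↔ Carrier
    scale = mk↔ₛ′ (x *_) (x ⁻¹ *_) (x*[x⁻¹*y]≡y x≢0) (x⁻¹*[x*y]≡y x≢0)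

    Π≡Π : product (at-nonzero x ∘ element) * product (h ∘ element) ≡ product (h ∘ element)
    Π≡Π = begin
      product (at-nonzero x ∘ element) * product (h ∘ element)  ≡⟨ ∏-distrib-* (at-nonzero x ∘ element) (h ∘ element) ⟨
      product (λ i → at-nonzero x (element i) * h (element i))  ≡⟨ product-cong (λ i → h-shift (element i)) ⟩
      product (λ i → h (x * element i))                         ≡⟨ sum-reindex *-commutativeMonoid scale h ⟨
      product (h ∘ element)                                     ∎

  ∣⇒×≡0 : ∀ {p m} → p ×ⁿ 1# ≡ 0# → p ∣ m → ∀ x → m ×ⁿ x ≡ 0#
  ∣⇒×≡0 {p} p×1≡0 (divides c refl) x = begin
    (c ℕ.* p) ×ⁿ x                ≡⟨ cong ((c ℕ.* p) ×ⁿ_) (*-identityˡ x) ⟨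
    (c ℕ.* p) ×ⁿ (1# * x)         ≡⟨ ×-assoc-* (c ℕ.* p) 1# x ⟨
    (c ℕ.* p) ×ⁿ 1# * x           ≡⟨ cong (_* x) (×1-homo-* c p) ⟩
    c ×ⁿ 1# * p ×ⁿ 1# * x         ≡⟨ cong (λ z → c ×ⁿ 1# * z * x) p×1≡0 ⟩
    c ×ⁿ 1# * 0# * x              ≡⟨ solve 2 (λ a x → a :* :0 :* x := :0) refl (c ×ⁿ 1#) x ⟩
    0#                            ∎

  module Frobenius {p} (p-prime : Prime p) (p×1≡0 : p ×ⁿ 1# ≡ 0#) where
    open Sum +-commutativeMonoid using (sum; sum-init-last; sum-cong-≗; sum-replicate-zero)

    frobenius-+ : ∀ x y → (x + y) ^ p ≡ x ^ p + y ^ p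
    frobenius-+ x y = expand p p-prime p×1≡0 (Binomial.theorem commutativeSemiring p x y)
      where
      -- `p` is a module parameter; quantifying over it again permits the split into `suc p-1` that
      -- detaches the two extreme terms of the binomial sum.
      expand : ∀ p → Prime p → p ×ⁿ 1# ≡ 0# →
               (x + y) ^ p ≡ sum {suc p} (λ k → (p C toℕ k) ×ⁿ (x ^ toℕ k * y ^ (p ∸ toℕ k))) → (x + y) ^ p ≡ x ^ p + y ^ p
      expand zero          p-prime _     _  = contradiction p-prime ¬prime[0]
      expand p@(suc p-1) p-prime p×1≡0 eq = begin
        (x + y) ^ p                         ≡⟨ eq ⟩
        sum term                            ≡⟨⟩
        term zero + sum (term ∘ suc)        ≡⟨ cong₂ _+_ first (sum-init-last (term ∘ suc)) ⟩
        y ^ p + (sum (init (term ∘ suc)) + term (fromℕ p)) ≡⟨ cong (λ z → y ^ p + z) (cong₂ _+_ middle end) ⟩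
        y ^ p + (0# + x ^ p)                ≡⟨ solve 2 (λ x y → y :+ (:0 :+ x) := x :+ y) refl (x ^ p) (y ^ p) ⟩
        x ^ p + y ^ p                       ∎
        where
        term : Fin (suc p) → Carrier
        term k = (p C toℕ k) ×ⁿ (x ^ toℕ k * y ^ (p ∸ toℕ k))
        pC0≡1 : p C 0 ≡ 1
        pC0≡1 = trans (nCk≡nC[n∸k] {k = 0} {n = p} z≤n) (nCn≡1 p)
        first : term zero ≡ y ^ p
        first = trans (cong (_×ⁿ (1# * y ^ p)) pC0≡1) (solve 1 (λ y → :1 :* y :+ :0 := y) refl (y ^ p))
        end : term (fromℕ p) ≡ x ^ p
        end rewrite toℕ-fromℕ p-1 | nCn≡1 p | ℕₚ.n∸n≡0 p-1 = solve 1 (λ x → x :* :1 :+ :0 := x) refl (x ^ p)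
        middle : sum (init (term ∘ suc)) ≡ 0#
        middle = trans (sum-cong-≗ λ i → ∣⇒×≡0 p×1≡0 (prime∣C p-prime (suc (toℕ (inject₁ i))) (s≤s z≤n)
                   (s≤s (subst (_< p-1) (sym (toℕ-inject₁ i)) (toℕ<n i)))) _) (sum-replicate-zero p-1)

    frobenius^-+ : ∀ k x y → (x + y) ^ (p ℕ.^ k) ≡ x ^ (p ℕ.^ k) + y ^ (p ℕ.^ k)
    frobenius^-+ zero    x y = solve 2 (λ x y → (x :+ y) :* :1 := x :* :1 :+ y :* :1) refl x y
    frobenius^-+ (suc k) x y = begin
      (x + y) ^ (p ℕ.* p ℕ.^ k)                         ≡⟨ ^-assocʳ (x + y) p (p ℕ.^ k) ⟨
      ((x + y) ^ p) ^ (p ℕ.^ k)                         ≡⟨ cong (_^ (p ℕ.^ k)) (frobenius-+ x y) ⟩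
      (x ^ p + y ^ p) ^ (p ℕ.^ k)                       ≡⟨ frobenius^-+ k (x ^ p) (y ^ p) ⟩
      (x ^ p) ^ (p ℕ.^ k) + (y ^ p) ^ (p ℕ.^ k)         ≡⟨ cong₂ _+_ (^-assocʳ x p (p ℕ.^ k)) (^-assocʳ y p (p ℕ.^ k)) ⟩
      x ^ (p ℕ.* p ℕ.^ k) + y ^ (p ℕ.* p ℕ.^ k)         ∎

  -- Roots of monic polynomials

  -- Polynomials stay functions, with a certificate of degree and leading coefficient; in Horner
  -- form, division by x - r is a structural recursion.
  data Monic : ℕ → (Carrier → Carrier) → Set where
    one    : Monic 0 (const 1#)
    horner : ∀ {d P} → Monic d P → ∀ c → Monic (suc d) (λ x → x * P x + c)

  -- Synthetic division: if P = (x - r) Q + P(r), then x P + c has the quotient x Q + P(r).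
  deflate : ∀ {d P} → Monic (suc d) P → ∀ r → ∃[ Q ] (Monic d Q × (∀ x → P x - P r ≡ (x - r) * Q x))
  deflate (horner {zero} one c) r = const 1# , one , λ x →
    solve 3 (λ x r c → (x :* :1 :+ c) :- (r :* :1 :+ c) := (x :- r) :* :1) refl x r c
  deflate (horner {suc d} {P} P-monic c) r with Q , Q-monic , eq ← deflate P-monic r =
    (λ x → x * Q x + P r) , horner Q-monic (P r) , λ x → begin
      (x * P x + c) - (r * P r + c)          ≡⟨ solve 5 (λ x r c px pr → (x :* px :+ c) :- (r :* pr :+ c) := x :* (px :- pr) :+ (x :- r) :* pr) refl x r c (P x) (P r) ⟩
      x * (P x - P r) + (x - r) * P r        ≡⟨ cong (λ z → x * z + (x - r) * P r) (eq x) ⟩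
      x * ((x - r) * Q x) + (x - r) * P r    ≡⟨ solve 4 (λ x r q pr → x :* ((x :- r) :* q) :+ (x :- r) :* pr := (x :- r) :* (x :* q :+ pr)) refl x r (Q x) (P r) ⟩
      (x - r) * (x * Q x + P r)              ∎

  root-bound : ∀ {d P} → Monic d P → (r : Fin (suc d) → Carrier) → Injective _≡_ _≡_ r → ¬ (∀ i → P (r i) ≡ 0#)
  root-bound {zero} one r r-inj roots = 1≢0 (roots zero)
  root-bound {suc d} {P} P-monic r r-inj roots with Q , Q-monic , eq ← deflate P-monic (r zero) =
    root-bound Q-monic (r ∘ suc) (Finₚ.suc-injective ∘ r-inj) λ i →
      *-cancelˡ (nonzero-difference {r (suc i)} {r zero} λ e → contradiction (r-inj e) λ ()) (begin
        (r (suc i) - r zero) * Q (r (suc i))  ≡⟨ eq (r (suc i)) ⟨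
        P (r (suc i)) - P (r zero)            ≡⟨ x≡y⇒x-y≡0 (trans (roots (suc i)) (sym (roots zero))) ⟩
        0#                                    ≡⟨ zeroʳ _ ⟨
        (r (suc i) - r zero) * 0#             ∎)

  ^-monic : ∀ d → ∃[ P ] (Monic d P × (∀ x → P x ≡ x ^ d))
  ^-monic zero    = const 1# , one , λ _ → refl
  ^-monic (suc d) with P , P-monic , P≡ ← ^-monic d =
    _ , horner P-monic 0# , λ x → trans (+-identityʳ _) (cong (x *_) (P≡ x))

  -- Such points are roots of x^(d-1) - 1, which has at most d - 1 of them. The equation `m ≡ d`
  -- lets the points be indexed by `suc (q ∸ 1)` while the exponent is q.
  fixed-points-bound : ∀ {m d} → m ≡ d → 1 < d → (r : Fin m → Carrier) → Injective _≡_ _≡_ r →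
                       (∀ i → r i ≢ 0#) → ¬ (∀ i → r i ^ d ≡ r i)
  fixed-points-bound {suc zero} refl (s≤s ())
  fixed-points-bound {suc (suc d)} refl _ r r-inj r≢0 fixed with P , P-monic , P≡ ← ^-monic d =
    root-bound (horner P-monic (- 1#)) r r-inj λ i → begin
      r i * P (r i) - 1#     ≡⟨ cong (λ z → r i * z - 1#) (P≡ (r i)) ⟩
      r i ^ suc d - 1#       ≡⟨ x≡y⇒x-y≡0 (*-cancelˡ (r≢0 i) (trans (fixed i) (sym (trans (*-comm _ _) (*-identityˡ _))))) ⟩
      0#                     ∎

  nonzero : Fin (n ∸ 1) → Carrier
  nonzero i = element (skip (index 0#) i)

  nonzero-injective : Injective _≡_ _≡_ nonzero
  nonzero-injective = skip-injective (index 0#) ∘ element-injective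

  nonzero≢0 : ∀ i → nonzero i ≢ 0#
  nonzero≢0 i eq = skip≢ (index 0#) i (trans (sym (index-element _)) (cong index eq))

-- The extension 𝔽_q ⊆ 𝔽_{q^t}

module ExtensionTheory {q t : ℕ} (q-primePower : IsPrimePower q) (1<q : 1 < q) (E : FieldExtension q t) where
  open Geometry E public
  module K = FieldTheory 𝕂
  open FieldTheory 𝔽 public
  open IsRingHomomorphism ι-hom public using ()
    renaming (+-homo to ι-+; *-homo to ι-*; 0#-homo to ι-0; 1#-homo to ι-1; -‿homo to ι-neg)
  open ≡-Reasoning

  ι-nonzero : ∀ {a} → a ≢ K.0# → ι a ≢ 0#
  ι-nonzero {a} a≢0 ιa≡0 = 1≢0 (begin
    1#                ≡⟨ ι-1 ⟨
    ι K.1#            ≡⟨ cong ι (K.*-inverseʳ a a≢0) ⟨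
    ι (a K.* a K.⁻¹)  ≡⟨ ι-* a (a K.⁻¹) ⟩
    ι a * ι (a K.⁻¹)  ≡⟨ cong (_* ι (a K.⁻¹)) ιa≡0 ⟩
    0# * ι (a K.⁻¹)   ≡⟨ zeroˡ _ ⟩
    0#                ∎)

  ι-injective : Injective _≡_ _≡_ ι
  ι-injective {a} {b} ιa≡ιb = decidable-stable (a K.≟ b) λ a≢b → ι-nonzero (K.nonzero-difference a≢b) (begin
    ι (a K.+ K.- b)    ≡⟨ ι-+ a (K.- b) ⟩
    ι a + ι (K.- b)    ≡⟨ cong (ι a +_) (ι-neg b) ⟩
    ι a - ι b          ≡⟨ x≡y⇒x-y≡0 ιa≡ιb ⟩
    0#                 ∎)

  ι-^ : ∀ a k → ι (a K.^ k) ≡ ι a ^ k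
  ι-^ a zero    = ι-1
  ι-^ a (suc k) = trans (ι-* a (a K.^ k)) (cong (ι a *_) (ι-^ a k))

  ι-fixed : ∀ a → ι a ^ q ≡ ι a
  ι-fixed a = trans (sym (ι-^ a q)) (cong ι (K.fermat a))

  0^q≡0 : 0# ^ q ≡ 0#
  0^q≡0 = trans (cong (_^ q) (sym ι-0)) (trans (ι-fixed K.0#) ι-0)

  suc[q∸1]≡q : suc (q ∸ 1) ≡ q
  suc[q∸1]≡q = ℕₚ.m+[n∸m]≡n (ℕₚ.<⇒≤ 1<q)

  -- 𝔽_q^* already supplies q - 1 nonzero solutions of x^q = x; an element outside the image of `ι`
  -- would be one solution too many.
  fixed⇒∈K : ∀ y → y ^ q ≡ y → ∃[ a ] ι a ≡ y
  fixed⇒∈K y y^q≡y = decidable-stable (K.∃? λ a → ι a ≟ y) λ y∉K →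
    let r : Fin (suc (q ∸ 1)) → F
        r = λ { zero → y ; (suc i) → ι (K.nonzero i) }
        r-injective : Injective _≡_ _≡_ r
        r-injective = λ { {zero} {zero} _ → refl ; {zero} {suc j} eq → contradiction (K.nonzero j , sym eq) y∉K
                        ; {suc i} {zero} eq → contradiction (K.nonzero i , eq) y∉K
                        ; {suc i} {suc j} eq → cong suc (K.nonzero-injective (ι-injective eq)) }
    in fixed-points-bound suc[q∸1]≡q 1<q r r-injective
         (λ { zero y≡0 → y∉K (K.0# , trans ι-0 (sym y≡0)) ; (suc i) → ι-nonzero (K.nonzero≢0 i) })
         (λ { zero → y^q≡y ; (suc i) → ι-fixed (K.nonzero i) })

  -- The characteristic p is read off `𝕂`, whose order is p^k, and carried over by `ι`; the map is
  -- then the k-th iterate of x ↦ x^p.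
  ^q-+ : ∀ x y → (x + y) ^ q ≡ x ^ q + y ^ q
  ^q-+ = expand q-primePower
    where
    expand : IsPrimePower q → ∀ x y → (x + y) ^ q ≡ x ^ q + y ^ q
    expand (p , k , p-prime , _ , refl) = Frobenius.frobenius^-+ p-prime (begin
      p ×ⁿ 1#            ≡⟨ ι-×1 p ⟨
      ι (p K.×ⁿ K.1#)    ≡⟨ cong ι (K.characteristic {p} {k} refl) ⟩
      ι K.0#             ≡⟨ ι-0 ⟩
      0#                 ∎) k
      where
      ι-×1 : ∀ m → ι (m K.×ⁿ K.1#) ≡ m ×ⁿ 1#
      ι-×1 zero    = ι-0
      ι-×1 (suc m) = trans (ι-+ K.1# _) (cong₂ _+_ ι-1 (ι-×1 m))

  -- 𝔽_q-linear maps as linearized polynomials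

  record IsKLinear (g : F → F) : Set where
    field
      +-homo : ∀ x y → g (x + y) ≡ g x + g y
      ·-homo : ∀ a x → g (ι a * x) ≡ ι a * g x

    0-homo : g 0# ≡ 0#
    0-homo = begin
      g 0#               ≡⟨ cong g (trans (cong (_* 0#) ι-0) (zeroˡ 0#)) ⟨
      g (ι K.0# * 0#)    ≡⟨ ·-homo K.0# 0# ⟩
      ι K.0# * g 0#      ≡⟨ trans (cong (_* g 0#) ι-0) (zeroˡ (g 0#)) ⟩
      0#                 ∎

    x-ay : ∀ a x y → g (x - ι a * y) ≡ g x - ι a * g y
    x-ay a x y = begin
      g (x - ι a * y)          ≡⟨ cong g (cong (x +_) (solve 2 (λ a y → :- (a :* y) := (:- a) :* y) refl (ι a) y)) ⟩
      g (x + (- ι a) * y)      ≡⟨ cong (λ z → g (x + z * y)) (ι-neg a) ⟨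
      g (x + ι (K.- a) * y)    ≡⟨ +-homo _ _ ⟩
      g x + g (ι (K.- a) * y)  ≡⟨ cong (g x +_) (·-homo _ _) ⟩
      g x + ι (K.- a) * g y    ≡⟨ cong (λ z → g x + z * g y) (ι-neg a) ⟩
      g x + (- ι a) * g y      ≡⟨ solve 3 (λ x a y → x :+ (:- a) :* y := x :- a :* y) refl (g x) (ι a) (g y) ⟩
      g x - ι a * g y          ∎

    -‿homo : ∀ x y → g (x - y) ≡ g x - g y
    -‿homo x y = begin
      g (x - y)             ≡⟨ cong (λ z → g (x - z)) (1·≡ y) ⟨
      g (x - ι K.1# * y)    ≡⟨ x-ay K.1# x y ⟩
      g x - ι K.1# * g y    ≡⟨ cong (λ z → g x - z) (1·≡ (g y)) ⟩
      g x - g y             ∎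
      where
      1·≡ : ∀ z → ι K.1# * z ≡ z
      1·≡ z = trans (cong (_* z) ι-1) (*-identityˡ z)

  difference-linear : ∀ {g h} → IsKLinear g → IsKLinear h → IsKLinear (λ x → g x - h x)
  difference-linear {g} {h} g-lin h-lin = record
    { +-homo = λ x y → trans (cong₂ _-_ (g.+-homo x y) (h.+-homo x y))
        (solve 4 (λ a b c d → (a :+ b) :- (c :+ d) := (a :- c) :+ (b :- d)) refl (g x) (g y) (h x) (h y))
    ; ·-homo = λ a x → trans (cong₂ _-_ (g.·-homo a x) (h.·-homo a x))
        (solve 3 (λ a b c → a :* b :- a :* c := a :* (b :- c)) refl (ι a) (g x) (h x))
    }
    where
    module g = IsKLinear g-lin
    module h = IsKLinear h-lin

  -- ⟪ a₀ ∷ a₁ ∷ … ⟫ x = a₀ x + a₁ x^q + a₂ x^{q²} + …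
  ⟪_⟫ : List F → F → F
  ⟪ [] ⟫     x = 0#
  ⟪ c ∷ cs ⟫ x = c * x + ⟪ cs ⟫ (x ^ q)

  ⟪⟫-linear : ∀ cs → IsKLinear ⟪ cs ⟫
  ⟪⟫-linear [] = record { +-homo = λ _ _ → sym (+-identityˡ 0#) ; ·-homo = λ a _ → sym (zeroʳ (ι a)) }
  ⟪⟫-linear (c ∷ cs) = record
    { +-homo = λ x y → begin
        c * (x + y) + ⟪ cs ⟫ ((x + y) ^ q)               ≡⟨ cong (λ z → c * (x + y) + ⟪ cs ⟫ z) (^q-+ x y) ⟩
        c * (x + y) + ⟪ cs ⟫ (x ^ q + y ^ q)             ≡⟨ cong (c * (x + y) +_) (cs.+-homo (x ^ q) (y ^ q)) ⟩
        c * (x + y) + (⟪ cs ⟫ (x ^ q) + ⟪ cs ⟫ (y ^ q))  ≡⟨ solve 5 (λ c x y z w → c :* (x :+ y) :+ (z :+ w) := (c :* x :+ z) :+ (c :* y :+ w)) refl c x y _ _ ⟩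
        (c * x + ⟪ cs ⟫ (x ^ q)) + (c * y + ⟪ cs ⟫ (y ^ q)) ∎
    ; ·-homo = λ a x → begin
        c * (ι a * x) + ⟪ cs ⟫ ((ι a * x) ^ q)     ≡⟨ cong (λ z → c * (ι a * x) + ⟪ cs ⟫ z) (trans (^-distrib-* (ι a) x q) (cong (_* x ^ q) (ι-fixed a))) ⟩
        c * (ι a * x) + ⟪ cs ⟫ (ι a * x ^ q)       ≡⟨ cong (c * (ι a * x) +_) (cs.·-homo a (x ^ q)) ⟩
        c * (ι a * x) + ι a * ⟪ cs ⟫ (x ^ q)       ≡⟨ solve 4 (λ c a x z → c :* (a :* x) :+ a :* z := a :* (c :* x :+ z)) refl c (ι a) x _ ⟩
        ι a * (c * x + ⟪ cs ⟫ (x ^ q))             ∎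
    }
    where module cs = IsKLinear (⟪⟫-linear cs)

  infixl 6 _⊕_
  _⊕_ : List F → List F → List F
  []       ⊕ ds       = ds
  (c ∷ cs) ⊕ []       = c ∷ cs
  (c ∷ cs) ⊕ (d ∷ ds) = c + d ∷ cs ⊕ ds

  ⟪⊕⟫ : ∀ cs ds x → ⟪ cs ⊕ ds ⟫ x ≡ ⟪ cs ⟫ x + ⟪ ds ⟫ x
  ⟪⊕⟫ []       ds       x = sym (+-identityˡ _)
  ⟪⊕⟫ (c ∷ cs) []       x = sym (+-identityʳ _)
  ⟪⊕⟫ (c ∷ cs) (d ∷ ds) x = trans (cong ((c + d) * x +_) (⟪⊕⟫ cs ds (x ^ q)))
    (solve 5 (λ c d x z w → (c :+ d) :* x :+ (z :+ w) := (c :* x :+ z) :+ (d :* x :+ w)) refl c d x _ _)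

  ⟪scale⟫ : ∀ c cs x → ⟪ map (c *_) cs ⟫ x ≡ c * ⟪ cs ⟫ x
  ⟪scale⟫ c []       x = sym (zeroʳ c)
  ⟪scale⟫ c (d ∷ cs) x = trans (cong (c * d * x +_) (⟪scale⟫ c cs (x ^ q)))
    (solve 4 (λ c d x z → c :* d :* x :+ c :* z := c :* (d :* x :+ z)) refl c d x _)

  -- This is what makes `0# ∷ map (_^ q) M` the coefficient list of M(x)^q.
  ⟪map^q⟫ : ∀ cs x → ⟪ map (_^ q) cs ⟫ (x ^ q) ≡ ⟪ cs ⟫ x ^ q
  ⟪map^q⟫ []       x = sym 0^q≡0
  ⟪map^q⟫ (c ∷ cs) x = begin
    c ^ q * x ^ q + ⟪ map (_^ q) cs ⟫ ((x ^ q) ^ q)  ≡⟨ cong₂ _+_ (sym (^-distrib-* c x q)) (⟪map^q⟫ cs (x ^ q)) ⟩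
    (c * x) ^ q + ⟪ cs ⟫ (x ^ q) ^ q                 ≡⟨ ^q-+ _ _ ⟨
    (c * x + ⟪ cs ⟫ (x ^ q)) ^ q                     ∎

  -- Newton interpolation: `annihilator` plays the role of ∏(x - xᵢ).
  record Interpolant (g : F → F) (xs : List F) : Set where
    field
      annihilator  : List F
      annihilates  : ∀ {x} → x ∈ xs → ⟪ annihilator ⟫ x ≡ 0#
      minimal      : ∀ {l} → IsKLinear l → (∀ {x} → x ∈ xs → l x ≡ 0#) → ∀ y → ⟪ annihilator ⟫ y ≡ 0# → l y ≡ 0#
      interpolant  : List F
      interpolates : ∀ {x} → x ∈ xs → ⟪ interpolant ⟫ x ≡ g x

  -- The invariant `minimal` says that the kernel of the annihilator is no larger than the 𝔽_q-span
  -- of the nodes. Testing against all linear maps that vanish at the nodes expresses this without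
  -- mentioning the span.
  interpolate : ∀ {g} → IsKLinear g → ∀ xs → Interpolant g xs
  interpolate g-lin [] = record
    { annihilator = 1# ∷ [] ; annihilates = λ () ; interpolant = [] ; interpolates = λ ()
    ; minimal = λ {l} l-lin _ y eq → begin
        l y   ≡⟨ cong l (trans (solve 1 (λ y → y := :1 :* y :+ :0) refl y) eq) ⟩
        l 0#  ≡⟨ IsKLinear.0-homo l-lin ⟩
        0#    ∎ }
  interpolate {g} g-lin (x ∷ xs) with interpolate g-lin xs
  ... | N with ⟪ Interpolant.annihilator N ⟫ x ≟ 0#
  ...   | yes Mx≡0 = record
    { annihilator = annihilator ; interpolant = interpolant
    ; annihilates = λ { (here refl) → Mx≡0 ; (there x′∈xs) → annihilates x′∈xs }
    ; minimal = λ l-lin l≡0 → minimal l-lin (l≡0 ∘ there)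
    -- Here x is already in the span of the earlier nodes: the difference of the interpolant and g
    -- vanishes at them, hence also at x by minimality.
    ; interpolates = λ { (here refl) → x-y≡0⇒x≡y (minimal (difference-linear (⟪⟫-linear interpolant) g-lin)
                           (λ x′∈xs → x≡y⇒x-y≡0 (interpolates x′∈xs)) x Mx≡0)
                       ; (there x′∈xs) → interpolates x′∈xs } }
    where open Interpolant N
  ...   | no Mx≢0 = record
    { annihilator = M′ ; interpolant = f′
    ; annihilates = λ
      { (here refl) → begin
          ⟪ M′ ⟫ x                              ≡⟨ M′≡ x ⟩
          m ^ q - (m ^ q * m ⁻¹) * m            ≡⟨ solve 3 (λ a b c → a :- (a :* b) :* c := a :* (:1 :- b :* c)) refl (m ^ q) (m ⁻¹) m ⟩
          m ^ q * (1# - m ⁻¹ * m)               ≡⟨ cong (m ^ q *_) (x≡y⇒x-y≡0 (sym (*-inverseˡ Mx≢0))) ⟩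
          m ^ q * 0#                            ≡⟨ zeroʳ _ ⟩
          0#                                    ∎
      ; (there {xs = _} x′∈xs) → begin
          ⟪ M′ ⟫ _                              ≡⟨ M′≡ _ ⟩
          ⟪ M ⟫ _ ^ q - c * ⟪ M ⟫ _             ≡⟨ cong (λ z → z ^ q - c * z) (annihilates x′∈xs) ⟩
          0# ^ q - c * 0#                       ≡⟨ cong (λ z → z - c * 0#) 0^q≡0 ⟩
          0# - c * 0#                           ≡⟨ solve 1 (λ c → :0 :- c :* :0 := :0) refl c ⟩
          0#                                    ∎ }
    ; minimal = minimal′
    ; interpolates = λ
      { (here refl) → begin
          ⟪ f′ ⟫ x                              ≡⟨ f′≡ x ⟩
          ⟪ f ⟫ x + d * m                       ≡⟨ solve 4 (λ f g n m → f :+ (g :- f) :* n :* m := f :+ (g :- f) :* (n :* m)) refl (⟪ f ⟫ x) (g x) (m ⁻¹) m ⟩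
          ⟪ f ⟫ x + (g x - ⟪ f ⟫ x) * (m ⁻¹ * m) ≡⟨ cong (λ z → ⟪ f ⟫ x + (g x - ⟪ f ⟫ x) * z) (*-inverseˡ Mx≢0) ⟩
          ⟪ f ⟫ x + (g x - ⟪ f ⟫ x) * 1#        ≡⟨ solve 2 (λ f g → f :+ (g :- f) :* :1 := g) refl (⟪ f ⟫ x) (g x) ⟩
          g x                                   ∎
      ; {x′} (there x′∈xs) → begin
          ⟪ f′ ⟫ x′                             ≡⟨ f′≡ x′ ⟩
          ⟪ f ⟫ x′ + d * ⟪ M ⟫ x′               ≡⟨ cong₂ (λ z w → z + d * w) (interpolates x′∈xs) (annihilates x′∈xs) ⟩
          g x′ + d * 0#                         ≡⟨ solve 2 (λ g d → g :+ d :* :0 := g) refl (g x′) d ⟩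
          g x′                                  ∎ } }
    where
    open Interpolant N renaming (annihilator to M; interpolant to f)
    m c d : F
    m = ⟪ M ⟫ x
    -- c is m^(q-1), so that M^q - c M vanishes at x; its zeros are the y with M(y)/m in 𝔽_q. The
    -- factor d makes f + d M take the value g(x) at x and changes nothing at the earlier nodes.
    c = m ^ q * m ⁻¹
    d = (g x - ⟪ f ⟫ x) * m ⁻¹

    M′ f′ : List F
    M′ = (0# ∷ map (_^ q) M) ⊕ map ((- c) *_) M
    f′ = f ⊕ map (d *_) M

    M′≡ : ∀ y → ⟪ M′ ⟫ y ≡ ⟪ M ⟫ y ^ q - c * ⟪ M ⟫ y
    M′≡ y = begin
      ⟪ M′ ⟫ y                                                  ≡⟨ ⟪⊕⟫ (0# ∷ map (_^ q) M) (map ((- c) *_) M) y ⟩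
      0# * y + ⟪ map (_^ q) M ⟫ (y ^ q) + ⟪ map ((- c) *_) M ⟫ y ≡⟨ cong₂ (λ z w → 0# * y + z + w) (⟪map^q⟫ M y) (⟪scale⟫ (- c) M y) ⟩
      0# * y + ⟪ M ⟫ y ^ q + (- c) * ⟪ M ⟫ y                    ≡⟨ solve 4 (λ y a c b → :0 :* y :+ a :+ (:- c) :* b := a :- c :* b) refl y _ c _ ⟩
      ⟪ M ⟫ y ^ q - c * ⟪ M ⟫ y                                 ∎

    f′≡ : ∀ y → ⟪ f′ ⟫ y ≡ ⟪ f ⟫ y + d * ⟪ M ⟫ y
    f′≡ y = trans (⟪⊕⟫ f (map (d *_) M) y) (cong (⟪ f ⟫ y +_) (⟪scale⟫ d M y))

    minimal′ : ∀ {l} → IsKLinear l → (∀ {x′} → x′ ∈ x ∷ xs → l x′ ≡ 0#) → ∀ y → ⟪ M′ ⟫ y ≡ 0# → l y ≡ 0#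
    minimal′ {l} l-lin l≡0 y M′y≡0 = begin
      l y                  ≡⟨ solve 2 (λ l a → l := l :- a :* :0) refl (l y) (ι a) ⟩
      l y - ι a * 0#       ≡⟨ cong (λ z → l y - ι a * z) (l≡0 (here refl)) ⟨
      l y - ι a * l x      ≡⟨ IsKLinear.x-ay l-lin a y x ⟨
      l (y - ι a * x)      ≡⟨ minimal l-lin (l≡0 ∘ there) _ (trans (IsKLinear.x-ay (⟪⟫-linear M) a y x) (x≡y⇒x-y≡0 (sym ιa*m≡))) ⟩
      0#                   ∎
      where
      u : F
      u = ⟪ M ⟫ y
      -- M′(y) = 0 reads u^q = m^(q-1) u, so u/m is some a in 𝔽_q, and y - a x lies in the kernel of
      -- M.
      fixed : (u * m ⁻¹) ^ q ≡ u * m ⁻¹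
      fixed = begin
        (u * m ⁻¹) ^ q             ≡⟨ ^-distrib-* u (m ⁻¹) q ⟩
        u ^ q * (m ⁻¹) ^ q         ≡⟨ cong (_* (m ⁻¹) ^ q) (x-y≡0⇒x≡y (trans (sym (M′≡ y)) M′y≡0)) ⟩
        m ^ q * m ⁻¹ * u * (m ⁻¹) ^ q    ≡⟨ solve 4 (λ a b c d → a :* b :* c :* d := (d :* a) :* (c :* b)) refl (m ^ q) (m ⁻¹) u ((m ⁻¹) ^ q) ⟩
        (m ⁻¹) ^ q * m ^ q * (u * m ⁻¹)  ≡⟨ cong (_* (u * m ⁻¹)) (^-distrib-* (m ⁻¹) m q) ⟨
        (m ⁻¹ * m) ^ q * (u * m ⁻¹)      ≡⟨ cong (λ z → z ^ q * (u * m ⁻¹)) (trans (*-inverseˡ Mx≢0) (sym ι-1)) ⟩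
        ι K.1# ^ q * (u * m ⁻¹)          ≡⟨ cong (_* (u * m ⁻¹)) (trans (ι-fixed K.1#) ι-1) ⟩
        1# * (u * m ⁻¹)                  ≡⟨ *-identityˡ _ ⟩
        u * m ⁻¹                         ∎
      a : K.Carrier
      a = proj₁ (fixed⇒∈K (u * m ⁻¹) fixed)
      ιa*m≡ : ι a * m ≡ u
      ιa*m≡ = begin
        ι a * m           ≡⟨ cong (_* m) (proj₂ (fixed⇒∈K (u * m ⁻¹) fixed)) ⟩
        u * m ⁻¹ * m      ≡⟨ solve 3 (λ u n m → u :* n :* m := n :* (m :* u)) refl u (m ⁻¹) m ⟩
        m ⁻¹ * (m * u)    ≡⟨ x⁻¹*[x*y]≡y Mx≢0 u ⟩
        u                 ∎

  -- A `LinearizedPolynomial` has at least one coefficient, so the empty list needs a zero; every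
  -- list thereby acquires a last coefficient 0.
  toPolynomial : List F → LinearizedPolynomial
  toPolynomial []       = record { k = 0 ; coef = const 0# }
  toPolynomial (c ∷ cs) = record { k = suc k ; coef = λ { zero → c ; (suc i) → coef i } }
    where open LinearizedPolynomial (toPolynomial cs)

  eval-toPolynomial : ∀ cs x → eval (toPolynomial cs) x ≡ ⟪ cs ⟫ x
  eval-toPolynomial []       x = solve 1 (λ x → :0 :* x :+ :0 := :0) refl _
  eval-toPolynomial (c ∷ cs) x = cong₂ (λ z w → c * z + w) (*-identityʳ x)
    (trans (Sum.sum-cong-≗ +-commutativeMonoid λ i → cong (coef i *_) (sym (^-assocʳ x q (q ℕ.^ toℕ i)))) (eval-toPolynomial cs (x ^ q)))
    where open LinearizedPolynomial (toPolynomial cs)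

  -- Abstract, lest the type checker unfold the interpolation.
  abstract
    linear⇒polynomial : ∀ {g} → IsKLinear g → ∃[ f ] (∀ x → eval f x ≡ g x)
    linear⇒polynomial {g} g-lin = toPolynomial interpolant , λ x →
      trans (eval-toPolynomial interpolant x)
        (subst (λ z → ⟪ interpolant ⟫ z ≡ g z) (element-index x) (interpolates (∈-tabulate⁺ (index x))))
      where open Interpolant (interpolate g-lin (tabulate element))

-- Vectors and points over 𝔽_{q^t}

module PlaneTheory {q t : ℕ} (q-primePower : IsPrimePower q) (1<q : 1 < q) (E : FieldExtension q t) where
  open ExtensionTheory q-primePower 1<q E public
  open ≡-Reasoning

  infixl 6 _-ᵥ_
  _-ᵥ_ : V → V → V
  (a , b) -ᵥ (c , d) = a - c , b - d

  infix 4 _≟ᵥ_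
  _≟ᵥ_ : ∀ (u v : V) → Dec (u ≡ v)
  (a , b) ≟ᵥ (c , d) = map′ (λ (p , q) → cong₂ _,_ p q) (λ eq → cong proj₁ eq , cong proj₂ eq) (a ≟ c ×-dec b ≟ d)

  +ᵥ-comm : ∀ u v → u +ᵥ v ≡ v +ᵥ u
  +ᵥ-comm _ _ = cong₂ _,_ (+-comm _ _) (+-comm _ _)

  +ᵥ-assoc : ∀ u v w → u +ᵥ v +ᵥ w ≡ u +ᵥ (v +ᵥ w)
  +ᵥ-assoc _ _ _ = cong₂ _,_ (+-assoc _ _ _) (+-assoc _ _ _)

  +ᵥ-identityˡ : ∀ v → 0ᵥ +ᵥ v ≡ v
  +ᵥ-identityˡ _ = cong₂ _,_ (+-identityˡ _) (+-identityˡ _)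

  +ᵥ-identityʳ : ∀ v → v +ᵥ 0ᵥ ≡ v
  +ᵥ-identityʳ _ = cong₂ _,_ (+-identityʳ _) (+-identityʳ _)

  u+v-v≡u : ∀ u v → u +ᵥ v -ᵥ v ≡ u
  u+v-v≡u (a , b) (c , d) = cong₂ _,_ (lemma a c) (lemma b d)
    where
    lemma : ∀ x y → x + y - y ≡ x
    lemma = solve 2 (λ x y → x :+ y :- y := x) refl

  u-v+v≡u : ∀ u v → u -ᵥ v +ᵥ v ≡ u
  u-v+v≡u (a , b) (c , d) = cong₂ _,_ (lemma a c) (lemma b d)
    where
    lemma : ∀ x y → x - y + y ≡ x
    lemma = solve 2 (λ x y → x :- y :+ y := x) refl

  +ᵥ-cancelʳ : ∀ {u v} w → u +ᵥ w ≡ v +ᵥ w → u ≡ v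
  +ᵥ-cancelʳ {u} {v} w eq = trans (sym (u+v-v≡u u w)) (trans (cong (_-ᵥ w) eq) (u+v-v≡u v w))

  -ᵥ-self : ∀ v → v -ᵥ v ≡ 0ᵥ
  -ᵥ-self (a , b) = cong₂ _,_ (-‿inverseʳ a) (-‿inverseʳ b)

  u-v≡0⇒u≡v : ∀ {u v} → u -ᵥ v ≡ 0ᵥ → u ≡ v
  u-v≡0⇒u≡v eq = cong₂ _,_ (x-y≡0⇒x≡y (cong proj₁ eq)) (x-y≡0⇒x≡y (cong proj₂ eq))

  ·-zeroˡ : ∀ v → 0# · v ≡ 0ᵥ
  ·-zeroˡ _ = cong₂ _,_ (zeroˡ _) (zeroˡ _)

  ·-zeroʳ : ∀ x → x · 0ᵥ ≡ 0ᵥ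
  ·-zeroʳ x = cong₂ _,_ (zeroʳ x) (zeroʳ x)

  ·-identity : ∀ v → 1# · v ≡ v
  ·-identity _ = cong₂ _,_ (*-identityˡ _) (*-identityˡ _)

  ·-assoc : ∀ x y v → (x * y) · v ≡ x · y · v
  ·-assoc _ _ _ = cong₂ _,_ (*-assoc _ _ _) (*-assoc _ _ _)

  ·-comm : ∀ x y v → x · y · v ≡ y · x · v
  ·-comm x y v = trans (sym (·-assoc x y v)) (trans (cong (_· v) (*-comm x y)) (·-assoc y x v))

  ·-distribˡ : ∀ x u v → x · (u +ᵥ v) ≡ x · u +ᵥ x · v
  ·-distribˡ _ _ _ = cong₂ _,_ (distribˡ _ _ _) (distribˡ _ _ _)

  ·-distribʳ : ∀ x y v → (x + y) · v ≡ x · v +ᵥ y · v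
  ·-distribʳ _ _ _ = cong₂ _,_ (distribʳ _ _ _) (distribʳ _ _ _)

  x⁻¹·x·v≡v : ∀ {x} → x ≢ 0# → ∀ v → x ⁻¹ · x · v ≡ v
  x⁻¹·x·v≡v {x} x≢0 v = trans (sym (·-assoc (x ⁻¹) x v)) (trans (cong (_· v) (*-inverseˡ x≢0)) (·-identity v))

  ·-cancelˡ : ∀ {x u v} → x ≢ 0# → x · u ≡ x · v → u ≡ v
  ·-cancelˡ {x} {u} {v} x≢0 eq = trans (sym (x⁻¹·x·v≡v x≢0 u)) (trans (cong (x ⁻¹ ·_) eq) (x⁻¹·x·v≡v x≢0 v))

  ·-nonzero : ∀ {x v} → x ≢ 0# → v ≢ 0ᵥ → x · v ≢ 0ᵥ
  ·-nonzero {x} x≢0 v≢0 eq = v≢0 (·-cancelˡ x≢0 (trans eq (sym (·-zeroʳ x))))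

  ·-nonzeroˡ : ∀ {x v} → x · v ≢ 0ᵥ → x ≢ 0#
  ·-nonzeroˡ {v = v} xv≢0 x≡0 = xv≢0 (trans (cong (_· v) x≡0) (·-zeroˡ v))

  ·-cancelʳ : ∀ {x y v} → v ≢ 0ᵥ → x · v ≡ y · v → x ≡ y
  ·-cancelʳ {x} {y} {a , b} v≢0 eq = decidable-stable (x ≟ y) λ x≢y → v≢0 (cong₂ _,_
      (lemma x≢y (cong proj₁ eq)) (lemma x≢y (cong proj₂ eq)))
    where
    lemma : ∀ {c} → x ≢ y → x * c ≡ y * c → c ≡ 0#
    lemma {c} x≢y xc≡yc = decidable-stable (c ≟ 0#) λ c≢0 → x≢y (*-cancelʳ c≢0 xc≡yc)

  1,m≢0 : ∀ {m} → (1# , m) ≢ 0ᵥ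
  1,m≢0 = 1≢0 ∘ cong proj₁

  self∈⟨⟩ : ∀ v → ⟨ v ⟩ v
  self∈⟨⟩ v = 1# , sym (·-identity v)

  ≈ₚ⇒multiple : ∀ {P Q} → P ≈ₚ Q → ∃[ x ] proj₁ P ≡ x · proj₁ Q
  ≈ₚ⇒multiple {P} P≈Q = proj₁ P≈Q (self∈⟨⟩ (proj₁ P))

  multiple⇒≈ₚ : ∀ {P Q x} → proj₁ P ≡ x · proj₁ Q → P ≈ₚ Q
  multiple⇒≈ₚ {v , v≢0} {w , w≢0} {x} refl =
    (λ { (y , refl) → y * x , sym (·-assoc y x w) }) ,
    (λ { (y , refl) → y * x ⁻¹ , sym (trans (·-assoc y (x ⁻¹) _) (cong (y ·_) (x⁻¹·x·v≡v (·-nonzeroˡ v≢0) w))) })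

  ≈ₚ-sym : ∀ {P Q} → P ≈ₚ Q → Q ≈ₚ P
  ≈ₚ-sym = ≐-sym

  ≈ₚ-trans : ∀ {P Q R} → P ≈ₚ Q → Q ≈ₚ R → P ≈ₚ R
  ≈ₚ-trans = ≐-trans

  -- Projection from a point outside L: subspaces as graphs

  -- If (1 , m₀) spans a point outside L, then κ moves that point to ⟨(0 , 1)⟩,
  -- so that κ(U) is a graph for every subspace U with L_U = L.
  module Coordinates (m₀ : F) where
    height : V → F
    height (a , b) = m₀ * a - b

    κ κ⁻¹ : V → V
    κ v@(a , b)     = height v , a
    κ⁻¹ (a , b) = b , m₀ * b - a

    height-+ : ∀ u v → height (u +ᵥ v) ≡ height u + height v
    height-+ (a , b) (c , d) = solve 5 (λ m a b c d → m :* (a :+ c) :- (b :+ d) := (m :* a :- b) :+ (m :* c :- d)) refl m₀ a b c d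

    height-· : ∀ x v → height (x · v) ≡ x * height v
    height-· x (a , b) = solve 4 (λ m x a b → m :* (x :* a) :- x :* b := x :* (m :* a :- b)) refl m₀ x a b

    height-difference : ∀ u v → height (u -ᵥ v) ≡ height u - height v
    height-difference (a , b) (c , d) = solve 5 (λ m a b c d → m :* (a :- c) :- (b :- d) := (m :* a :- b) :- (m :* c :- d)) refl m₀ a b c d

    κ⁻¹∘κ : ∀ v → κ⁻¹ (κ v) ≡ v
    κ⁻¹∘κ (a , b) = cong (a ,_) (solve 3 (λ m a b → m :* a :- (m :* a :- b) := b) refl m₀ a b)

    κ∘κ⁻¹ : ∀ v → κ (κ⁻¹ v) ≡ v
    κ∘κ⁻¹ (a , b) = cong (_, b) (solve 3 (λ m a b → m :* b :- (m :* b :- a) := a) refl m₀ a b)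

    κ-injective : Injective _≡_ _≡_ κ
    κ-injective {u} {v} eq = trans (sym (κ⁻¹∘κ u)) (trans (cong κ⁻¹ eq) (κ⁻¹∘κ v))

    κ-semilinear : IsSemilinear id κ
    κ-semilinear = record
      { +-homo = λ u v → cong (_, proj₁ u + proj₁ v) (height-+ u v)
      ; ·-homo = λ x v → cong (_, x * proj₁ v) (height-· x v)
      }

    κ-GL : GL
    κ-GL = record
      { κ = κ ; linear = κ-semilinear
      ; bijective = κ-injective , λ v → κ⁻¹ v , λ { refl → κ∘κ⁻¹ v } }

    κ-+ = IsSemilinear.+-homo κ-semilinear
    κ-· = IsSemilinear.·-homo κ-semilinear

    κ⁻¹-+ : ∀ u v → κ⁻¹ (u +ᵥ v) ≡ κ⁻¹ u +ᵥ κ⁻¹ v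
    κ⁻¹-+ u v = κ-injective (trans (κ∘κ⁻¹ _) (sym (trans (κ-+ _ _) (cong₂ _+ᵥ_ (κ∘κ⁻¹ u) (κ∘κ⁻¹ v)))))

    κ⁻¹-· : ∀ x v → κ⁻¹ (x · v) ≡ x · κ⁻¹ v
    κ⁻¹-· x v = κ-injective (trans (κ∘κ⁻¹ _) (sym (trans (κ-· x _) (cong (x ·_) (κ∘κ⁻¹ v)))))

    projectivity-cong : ∀ {P Q} → P ≈ₚ Q → projectivity κ-GL P ≈ₚ projectivity κ-GL Q
    projectivity-cong {P} {Q} P≈Q with x , eq ← ≈ₚ⇒multiple {P} {Q} P≈Q =
      multiple⇒≈ₚ {projectivity κ-GL P} {projectivity κ-GL Q} (trans (cong κ eq) (κ-· x (proj₁ Q)))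

  module PointCount {L : Pred Point 0ℓ} {N : ℕ} (L-card : HasCardinality L N) (count : suc (N ℕ.* (q ∸ 1)) ≡ q ℕ.^ t) where
    open HasCardinality L-card

    N<q^t : N < q ℕ.^ t
    N<q^t = subst (N <_) count (s≤s (ℕₚ.m≤m*n N (q ∸ 1) {{ℕ.>-nonZero (ℕₚ.m<n⇒0<n∸m 1<q)}}))

    -- Junk value 0⁻¹ at the point (0 , 1) is harmless: it only excludes one more m.
    exterior : ∃[ m₀ ] (∀ i → ¬ point i ≈ₚ ((1# , m₀) , 1,m≢0))
    exterior with j , omitted ← <⇒omits N<q^t (λ i → let (a , b) , _ = point i in index (b * a ⁻¹)) =
      element j , λ i pᵢ≈ → omitted i (trans (cong index (slope≡ (point i) (≈ₚ⇒multiple {point i} {_ , 1,m≢0} pᵢ≈))) (index-element j))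
      where
      slope≡ : ∀ (P : Point) {m} → ∃[ x ] proj₁ P ≡ x · (1# , m) → proj₂ (proj₁ P) * proj₁ (proj₁ P) ⁻¹ ≡ m
      slope≡ (_ , v≢0) {m} (x , refl) = begin
        x * m * (x * 1#) ⁻¹          ≡⟨ cong (λ z → x * m * z ⁻¹) (*-identityʳ x) ⟩
        x * m * x ⁻¹                 ≡⟨ solve 3 (λ x m n → x :* m :* n := n :* (x :* m)) refl x m (x ⁻¹) ⟩
        x ⁻¹ * (x * m)               ≡⟨ x⁻¹*[x*y]≡y (·-nonzeroˡ v≢0) m ⟩
        m                            ∎

    m₀ : F
    m₀ = proj₁ exterior

    open Coordinates m₀ public

    module GraphOfSubspace (U : Subspace) (L-U : LinearSet (carrier U) ≐ L) where
      open Subspace U hiding (carrier)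

      -ᵥ-closed : ∀ {u v} → carrier U u → carrier U v → carrier U (u -ᵥ v)
      -ᵥ-closed {u} {v} u∈U v∈U = subst (carrier U) (cong₂ _,_ (lemma (proj₁ u) (proj₁ v)) (lemma (proj₂ u) (proj₂ v)))
                                    (+ᵥ-closed u∈U (·ₖ-closed (K.- K.1#) v∈U))
        where
        lemma : ∀ x y → x + ι (K.- K.1#) * y ≡ x - y
        lemma x y = trans (cong (λ z → x + z * y) (trans (ι-neg K.1#) (cong -_ ι-1)))
                          (solve 2 (λ x y → x :+ (:- :1) :* y := x :- y) refl x y)

      -- A nonzero vector of height 0 is a multiple of (1 , m₀), and that point is not in L = L_U.
      height-zero : ∀ {v} → carrier U v → height v ≡ 0# → v ≡ 0ᵥ
      height-zero {v@(a , b)} v∈U h≡0 = decidable-stable (v ≟ᵥ 0ᵥ) λ v≢0 →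
        let i , pᵢ≈v = covering (v , v≢0) (proj₁ L-U ((v , v≢0) , v∈U , (id , id)))
            v≡ : v ≡ a · (1# , m₀)
            v≡ = cong₂ _,_ (solve 1 (λ a → a := a :* :1) refl a)
                           (trans (sym (x-y≡0⇒x≡y h≡0)) (*-comm m₀ a))
        in proj₂ exterior i (≈ₚ-trans {point i} {v , v≢0} {_ , 1,m≢0} pᵢ≈v (multiple⇒≈ₚ {v , v≢0} {_ , 1,m≢0} v≡))

      height-injective : ∀ {u v} → carrier U u → carrier U v → height u ≡ height v → u ≡ v
      height-injective {u} {v} u∈U v∈U eq =
        u-v≡0⇒u≡v (height-zero (-ᵥ-closed u∈U v∈U) (trans (height-difference u v) (x≡y⇒x-y≡0 eq)))

      representative : ∀ i → ∃[ v ] (carrier U v × Σ (v ≢ 0ᵥ) λ v≢0 → (v , v≢0) ≈ₚ point i)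
      representative i with (v , v≢0) , v∈U , v≈ ← proj₂ L-U (members i) = v , v∈U , v≢0 , v≈

      rep : Fin N → V
      rep = proj₁ ∘ representative

      rep∈U : ∀ i → carrier U (rep i)
      rep∈U = proj₁ ∘ proj₂ ∘ representative

      rep≢0 : ∀ i → rep i ≢ 0ᵥ
      rep≢0 = proj₁ ∘ proj₂ ∘ proj₂ ∘ representative

      rep-distinct : ∀ {i j x y} → x ≢ 0# → x · rep i ≡ y · rep j → i ≡ j
      rep-distinct {i} {j} {x} {y} x≢0 eq = distinct i j
        (≈ₚ-trans {point i} {Pᵢ} {point j} (≈ₚ-sym {Pᵢ} {point i} (rep≈ i))
          (≈ₚ-trans {Pᵢ} {Pⱼ} {point j} (multiple⇒≈ₚ {Pᵢ} {Pⱼ} {x ⁻¹ * y} rep≡) (rep≈ j)))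
        where
        Pᵢ Pⱼ : Point
        Pᵢ = rep i , rep≢0 i
        Pⱼ = rep j , rep≢0 j
        rep≈ : ∀ i → (rep i , rep≢0 i) ≈ₚ point i
        rep≈ = proj₂ ∘ proj₂ ∘ proj₂ ∘ representative
        rep≡ : rep i ≡ (x ⁻¹ * y) · rep j
        rep≡ = begin
          rep i              ≡⟨ x⁻¹·x·v≡v x≢0 (rep i) ⟨
          x ⁻¹ · x · rep i   ≡⟨ cong (x ⁻¹ ·_) eq ⟩
          x ⁻¹ · y · rep j   ≡⟨ ·-assoc (x ⁻¹) y (rep j) ⟨
          (x ⁻¹ * y) · rep j   ∎

      -- The heights of the 𝔽_q^*-multiples of one representative per point of L. They are distinct,
      -- since `height` is injective on U, and N(q - 1) in number.
      nonzeroMultiple : Fin (N ℕ.* (q ∸ 1)) → F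
      nonzeroMultiple k = let i , a = remQuot (q ∸ 1) k in ι (K.nonzero a) * height (rep i)

      height-rep≢0 : ∀ i → height (rep i) ≢ 0#
      height-rep≢0 i eq = rep≢0 i (height-zero (rep∈U i) eq)

      ι-nz≢0 : ∀ a → ι (K.nonzero a) ≢ 0#
      ι-nz≢0 a = ι-nonzero (K.nonzero≢0 a)

      nonzeroMultiple-injective : Injective _≡_ _≡_ nonzeroMultiple
      nonzeroMultiple-injective {k} {l} eq = begin
        k                                 ≡⟨ combine-remQuot {N} (q ∸ 1) k ⟨
        combine (proj₁ ia) (proj₂ ia)     ≡⟨ cong₂ combine i≡j a≡b ⟩
        combine (proj₁ jb) (proj₂ jb)     ≡⟨ combine-remQuot {N} (q ∸ 1) l ⟩
        l                                 ∎
        where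
        ia jb : Fin N × Fin (q ∸ 1)
        ia = remQuot (q ∸ 1) k
        jb = remQuot (q ∸ 1) l
        i≡j : proj₁ ia ≡ proj₁ jb
        i≡j = rep-distinct (ι-nz≢0 (proj₂ ia))
          (height-injective (·ₖ-closed _ (rep∈U _)) (·ₖ-closed _ (rep∈U _))
            (trans (height-· _ _) (trans eq (sym (height-· _ _)))))
        a≡b : proj₂ ia ≡ proj₂ jb
        a≡b = K.nonzero-injective (ι-injective (*-cancelʳ (height-rep≢0 (proj₁ ia))
          (trans eq (cong (λ i → ι (K.nonzero (proj₂ jb)) * height (rep i)) (sym i≡j)))))

      -- Together with 0 the values of `nonzeroMultiple` are 1 + N(q - 1) = q^t distinct elements,
      -- hence the whole field. The dimension of U is thus never assumed.
      heights-onto : ∀ {x} → x ≢ 0# → ∃₂ λ i a → x ≡ ι a * height (rep i)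
      heights-onto {x} x≢0 with injective⇒onto count {f} f-injective x
        where
        f : Fin (suc (N ℕ.* (q ∸ 1))) → F
        f zero    = 0#
        f (suc k) = nonzeroMultiple k
        f≢0 : ∀ k → nonzeroMultiple k ≢ 0#
        f≢0 k = nonzero-* (ι-nz≢0 _) (height-rep≢0 _)
        f-injective : Injective _≡_ _≡_ f
        f-injective {zero}  {zero}  _  = refl
        f-injective {zero}  {suc l} eq = contradiction (sym eq) (f≢0 l)
        f-injective {suc k} {zero}  eq = contradiction eq (f≢0 k)
        f-injective {suc k} {suc l} eq = cong suc (nonzeroMultiple-injective eq)
      ... | zero  , eq = contradiction (sym eq) x≢0
      ... | suc k , eq = proj₁ (remQuot {N} (q ∸ 1) k) , K.nonzero (proj₂ (remQuot {N} (q ∸ 1) k)) , sym eq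

      -- The index of the point of L spanned by the vector of U with height x. In this way the N
      -- points label the classes of nonzero scalars modulo 𝔽_q^*.
      class : ∀ x → x ≢ 0# → Fin N
      class x x≢0 = proj₁ (heights-onto x≢0)

      class-proportional : ∀ {x y} (x≢0 : x ≢ 0#) (y≢0 : y ≢ 0#) → class x x≢0 ≡ class y y≢0 → ∃[ c ] y ≡ ι c * x
      class-proportional {x} {y} x≢0 y≢0 eq
        with i , a , x≡ ← heights-onto x≢0 | j , b , y≡ ← heights-onto y≢0 with refl ← eq =
        b K.* a K.⁻¹ , (begin
          y                             ≡⟨ y≡ ⟩
          ι b * height (rep i)          ≡⟨ cong (λ z → ι z * height (rep i)) b≡ ⟩
          ι (b K.* a K.⁻¹ K.* a) * height (rep i)     ≡⟨ cong (_* height (rep i)) (ι-* _ a) ⟩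
          ι (b K.* a K.⁻¹) * ι a * height (rep i)     ≡⟨ *-assoc _ _ _ ⟩
          ι (b K.* a K.⁻¹) * (ι a * height (rep i))   ≡⟨ cong (ι (b K.* a K.⁻¹) *_) x≡ ⟨
          ι (b K.* a K.⁻¹) * x          ∎)
        where
        a≢0 : a ≢ K.0#
        a≢0 refl = nonzero-*ˡ (subst (_≢ 0#) x≡ x≢0) ι-0
        b≡ : b ≡ b K.* a K.⁻¹ K.* a
        b≡ = trans (sym (K.x⁻¹*[x*y]≡y a≢0 b)) (K.solve 3 (λ n a b → n K.:* (a K.:* b) K.:= b K.:* n K.:* a) refl (a K.⁻¹) a b)

      lift : ∀ x → ∃[ v ] (carrier U v × height v ≡ x)
      lift x with x ≟ 0#
      ... | yes refl = 0ᵥ , 0ᵥ∈ , solve 1 (λ m → m :* :0 :- :0 := :0) refl m₀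
      ... | no x≢0   = let i , a , x≡ = heights-onto x≢0 in
        a ·ₖ rep i , ·ₖ-closed a (rep∈U i) , trans (height-· (ι a) (rep i)) (sym x≡)

      section : F → V
      section = proj₁ ∘ lift

      section∈U : ∀ x → carrier U (section x)
      section∈U = proj₁ ∘ proj₂ ∘ lift

      height-section : ∀ x → height (section x) ≡ x
      height-section = proj₂ ∘ proj₂ ∘ lift

      section-unique : ∀ {x v} → carrier U v → height v ≡ x → section x ≡ v
      section-unique v∈U eq = height-injective (section∈U _) v∈U (trans (height-section _) (sym eq))

      section-linear : IsKLinear (proj₁ ∘ section)
      section-linear = record
        { +-homo = λ x y → cong proj₁ (section-unique (+ᵥ-closed (section∈U x) (section∈U y))
            (trans (height-+ (section x) (section y)) (cong₂ _+_ (height-section x) (height-section y))))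
        ; ·-homo = λ a x → cong proj₁ (section-unique (·ₖ-closed a (section∈U x))
            (trans (height-· (ι a) (section x)) (cong (ι a *_) (height-section x))))
        }

      f : LinearizedPolynomial
      f = proj₁ (linear⇒polynomial section-linear)

      eval-f : ∀ x → eval f x ≡ proj₁ (section x)
      eval-f = proj₂ (linear⇒polynomial section-linear)

      κ-section : ∀ x → κ (section x) ≡ (x , eval f x)
      κ-section x = cong₂ _,_ (height-section x) (sym (eval-f x))

      κ-U⊆graph : ∀ {v} → carrier U v → graph f (κ v)
      κ-U⊆graph {v} v∈U = height v , trans (cong κ (sym (section-unique v∈U refl))) (κ-section (height v))

      graph⊆κ-U : ∀ {w} → graph f w → ∃[ v ] (carrier U v × κ v ≡ w)
      graph⊆κ-U (x , refl) = section x , section∈U x , κ-section x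

      f-linear : IsKLinear (eval f)
      f-linear = record
        { +-homo = λ x y → trans (eval-f (x + y)) (trans (IsKLinear.+-homo section-linear x y) (sym (cong₂ _+_ (eval-f x) (eval-f y))))
        ; ·-homo = λ a x → trans (eval-f (ι a * x)) (trans (IsKLinear.·-homo section-linear a x) (cong (ι a *_) (sym (eval-f x))))
        }

      -- The hypothesis says z · (y , f y) = y · (z , f z). Pulled back by κ, it is an equation
      -- between 𝔽_{q^t}-multiples of two representatives, which must then represent the same point
      -- of L.
      equal-slopes⇒equal-class : ∀ {y z} (y≢0 : y ≢ 0#) (z≢0 : z ≢ 0#) →
                                 z * eval f y ≡ y * eval f z → class y y≢0 ≡ class z z≢0
      equal-slopes⇒equal-class {y} {z} y≢0 z≢0 eq
        with i , a , y≡ ← heights-onto y≢0 | j , b , z≡ ← heights-onto z≢0 =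
        rep-distinct {i} {j} {z * ι a} {y * ι b} (nonzero-* z≢0 (nonzero-*ˡ (subst (_≢ 0#) y≡ y≢0)))
          (κ-injective (begin
            κ ((z * ι a) · rep i)          ≡⟨ κ-multiple i a y≡ ⟩
            z * y , z * eval f y           ≡⟨ cong₂ _,_ (*-comm z y) eq ⟩
            y * z , y * eval f z           ≡⟨ κ-multiple j b z≡ ⟨
            κ ((y * ι b) · rep j)          ∎))
        where
        κ-multiple : ∀ {x y} i a → y ≡ ι a * height (rep i) → κ ((x * ι a) · rep i) ≡ (x * y , x * eval f y)
        κ-multiple {x} {y} i a y≡ = begin
          κ ((x * ι a) · rep i)         ≡⟨ cong κ (·-assoc x (ι a) (rep i)) ⟩
          κ (x · ι a · rep i)           ≡⟨ κ-· x _ ⟩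
          x · κ (ι a · rep i)           ≡⟨ cong (λ v → x · κ v) (section-unique (·ₖ-closed a (rep∈U i)) (trans (height-· _ _) (sym y≡))) ⟨
          x · κ (section y)             ≡⟨ cong (x ·_) (κ-section y) ⟩
          x · (y , eval f y)            ∎

      f-scattered : IsScatteredPolynomial f
      f-scattered y z eq with y ≟ 0# | z ≟ 0#
      ... | yes refl | _ = K.1# , K.0# , (λ (1≡0 , _) → K.1≢0 1≡0) ,
        trans (cong (λ w → ι K.1# * 0# + w * z) ι-0) (solve 2 (λ a z → a :* :0 :+ :0 :* z := :0) refl (ι K.1#) z)
      ... | no _     | yes refl = K.0# , K.1# , (λ (_ , 1≡0) → K.1≢0 1≡0) ,
        trans (cong (λ w → w * y + ι K.1# * 0#) ι-0) (solve 2 (λ a y → :0 :* y :+ a :* :0 := :0) refl (ι K.1#) y)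
      ... | no y≢0   | no z≢0 = proportional⇒dependent (class-proportional y≢0 z≢0 (equal-slopes⇒equal-class y≢0 z≢0 (x-y≡0⇒x≡y eq)))
        where
        proportional⇒dependent : ∃[ c ] z ≡ ι c * y → LinearlyDependent y z
        proportional⇒dependent (c , z≡cy) =
          c , K.- K.1# , (λ (_ , -1≡0) → K.1≢0 (trans (sym (K.+-identityʳ K.1#)) (trans (cong (K.1# K.+_) (sym -1≡0)) (K.-‿inverseʳ K.1#)))) , (begin
          ι c * y + ι (K.- K.1#) * z    ≡⟨ cong₂ (λ u w → u + w * z) (sym z≡cy) (trans (ι-neg K.1#) (cong -_ ι-1)) ⟩
          z + (- 1#) * z                ≡⟨ solve 1 (λ z → z :+ (:- :1) :* z := :0) refl z ⟩
          0#                            ∎)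

      -- The right-hand side is phrased with another subspace U₀ of the same linear set, so that it
      -- can be the given subspace, the same for all graphs.
      LinearSet-graph : ∀ {U₀} → LinearSet (carrier U₀) ≐ L →
                        LinearSet (graph f) ≐ imageₚ (projectivity κ-GL) (LinearSet (carrier U₀))
      LinearSet-graph {U₀} L-U₀ = (λ {P} → to {P}) , (λ {P} → from {P})
        where
        to : ∀ {P} → LinearSet (graph f) P → imageₚ (projectivity κ-GL) (LinearSet (carrier U₀)) P
        to {P} ((v , v≢0) , (x , refl) , v≈P) =
          (section x , s≢0) , proj₂ L-U₀ {section x , s≢0} (proj₁ L-U ((section x , s≢0) , section∈U x , (id , id))) ,
          ≈ₚ-trans {projectivity κ-GL (section x , s≢0)} {v , v≢0} {P}
            (multiple⇒≈ₚ {projectivity κ-GL (section x , s≢0)} {v , v≢0} {1#} (trans (κ-section x) (sym (·-identity _)))) v≈P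
          where
          s≢0 : section x ≢ 0ᵥ
          s≢0 s≡0 = v≢0 (trans (sym (κ-section x)) (trans (cong κ s≡0) (trans (cong κ (sym (·-zeroˡ 0ᵥ))) (trans (κ-· 0# 0ᵥ) (·-zeroˡ _)))))
        from : ∀ {P} → imageₚ (projectivity κ-GL) (LinearSet (carrier U₀)) P → LinearSet (graph f) P
        from {P} (R , R∈ , κR≈P) with Q , Q∈U , Q≈R ← proj₂ L-U {R} (proj₁ L-U₀ R∈) =
          projectivity κ-GL Q , κ-U⊆graph Q∈U ,
          ≈ₚ-trans {projectivity κ-GL Q} {projectivity κ-GL R} {P} (projectivity-cong {Q} {R} Q≈R) κR≈P

-- Planar spreads and additivity of collineations

module SpreadTheory {q t : ℕ} (q-primePower : IsPrimePower q) (1<q : 1 < q) (E : FieldExtension q t) where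
  open PlaneTheory q-primePower 1<q E public
  open ≡-Reasoning

  Complementary : Pred V 0ℓ → Pred V 0ℓ → Set
  Complementary A B = (∀ {v} → A v → B v → v ≡ 0ᵥ) × (∀ v → ∃₂ λ a b → A a × B b × v ≡ a +ᵥ b)

  -- Several indices may name one member, so the decomposition of V by two distinct members becomes
  -- `dichotomy`: two indices name equal or complementary members.
  record IsSpread {I : Set} (S : I → Pred V 0ℓ) : Set where
    field
      0∈         : ∀ i → S i 0ᵥ
      +-closed   : ∀ i {u v} → S i u → S i v → S i (u +ᵥ v)
      -ᵥ-closed   : ∀ i {u v} → S i u → S i v → S i (u -ᵥ v)
      cover      : ∀ v → ∃[ i ] S i v
      dichotomy  : ∀ i j → S i ≐ S j ⊎ Complementary (S i) (S j)
      complement : ∀ i → ∃[ j ] (Complementary (S i) (S j) × ∃[ w ] (S j w × w ≢ 0ᵥ))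

  0,1≢0 : (0# , 1#) ≢ 0ᵥ
  0,1≢0 = 1≢0 ∘ cong proj₂

  pair-injective⇒onto : {g : V → V} → Injective _≡_ _≡_ g → ∀ v → ∃[ u ] g u ≡ v
  pair-injective⇒onto {g} g-injective v =
    let k , eq = injective⇒surjective {f = encode ∘ g ∘ decode} (decode-injective ∘ g-injective ∘ encode-injective) (encode v)
    in decode k , encode-injective eq
    where
    encode : V → Fin (q ℕ.^ t ℕ.* q ℕ.^ t)
    encode (x , y) = combine (index x) (index y)
    decode : Fin (q ℕ.^ t ℕ.* q ℕ.^ t) → V
    decode k = let i , j = remQuot (q ℕ.^ t) k in element i , element j
    encode-injective : Injective _≡_ _≡_ encode
    encode-injective {x , y} {x′ , y′} eq =
      let p , r = combine-injective (index x) (index y) (index x′) (index y′) eq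
      in cong₂ _,_ (index-injective p) (index-injective r)
    decode-injective : Injective _≡_ _≡_ decode
    decode-injective {k} {l} eq = trans (sym (combine-remQuot {q ℕ.^ t} (q ℕ.^ t) k)) (trans
      (cong₂ combine (element-injective (cong proj₁ eq)) (element-injective (cong proj₂ eq)))
      (combine-remQuot {q ℕ.^ t} (q ℕ.^ t) l))

  module Collineation {I J : Set} {S : I → Pred V 0ℓ} {T : J → Pred V 0ℓ} (S-spread : IsSpread S) (T-spread : IsSpread T)
    (φ : V → V) (φ-injective : Injective _≡_ _≡_ φ)
    (φ-line : ∀ ℓ → ∃[ m ] (image φ (λ v → IncidenceStructure._on_ (translationPlane S) v ℓ) ≐ (λ v → IncidenceStructure._on_ (translationPlane T) v m))) where

    private
      module S = IsSpread S-spread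
      module T = IsSpread T-spread

    ψ : V → V
    ψ v = φ v -ᵥ φ 0ᵥ

    ψ-0 : ψ 0ᵥ ≡ 0ᵥ
    ψ-0 = -ᵥ-self (φ 0ᵥ)

    ψ-injective : Injective _≡_ _≡_ ψ
    ψ-injective {u} {v} eq = φ-injective (trans (sym (u-v+v≡u (φ u) (φ 0ᵥ))) (trans (cong (_+ᵥ φ 0ᵥ) eq) (u-v+v≡u (φ v) (φ 0ᵥ))))

    imageIndex : I → J
    imageIndex i = proj₁ (proj₁ (φ-line (i , 0ᵥ)))

    private
      a+w-[b+w]≡a-b : ∀ a b w → (a +ᵥ w) -ᵥ (b +ᵥ w) ≡ a -ᵥ b
      a+w-[b+w]≡a-b (a , a′) (b , b′) (w , w′) = cong₂ _,_ (lemma a b w) (lemma a′ b′ w′)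
        where
        lemma : ∀ a b w → (a + w) - (b + w) ≡ a - b
        lemma = solve 3 (λ a b w → (a :+ w) :- (b :+ w) := a :- b) refl

      collinear-difference : ∀ i w {u v} → S i u → S i v →
        T (proj₁ (proj₁ (φ-line (i , w)))) (φ (u +ᵥ w) -ᵥ φ (v +ᵥ w))
      collinear-difference i w {u} {v} u∈ v∈ with (k , w₁) , ⊆ , _ ← φ-line (i , w)
        with a , a∈ , φu≡ ← ⊆ (u +ᵥ w , (u , u∈ , refl) , refl) | b , b∈ , φv≡ ← ⊆ (v +ᵥ w , (v , v∈ , refl) , refl) =
        subst (T k) (sym (trans (cong₂ _-ᵥ_ φu≡ φv≡) (a+w-[b+w]≡a-b a b w₁))) (T.-ᵥ-closed k a∈ b∈)

      component-difference : ∀ i {u v} → S i u → S i v → T (imageIndex i) (φ u -ᵥ φ v)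
      component-difference i {u} {v} u∈ v∈ =
        subst (T (imageIndex i)) (cong₂ _-ᵥ_ (cong φ (+ᵥ-identityʳ u)) (cong φ (+ᵥ-identityʳ v))) (collinear-difference i 0ᵥ u∈ v∈)

    ψ-component : ∀ i {u} → S i u → T (imageIndex i) (ψ u)
    ψ-component i u∈ = component-difference i u∈ (S.0∈ i)

    ψ-component-onto : ∀ i {u′} → T (imageIndex i) u′ → ∃[ u ] (S i u × ψ u ≡ u′)
    ψ-component-onto i {u′} u′∈ with φ-line (i , 0ᵥ)
    ... | (k , w₀) , ⊆ , ⊇ with a , a∈ , φ0≡ ← ⊆ (0ᵥ , (0ᵥ , S.0∈ i , sym (+ᵥ-identityʳ 0ᵥ)) , refl)
      -- As φ 0 = a + w₀, the vector u′ + a + w₀ is the point of the image line that differs from φ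
      -- 0 by u′.
      with _ , (u , u∈ , refl) , φu≡ ← ⊇ (u′ +ᵥ a , T.+-closed k u′∈ a∈ , refl) =
      u , u∈ , (begin
        φ u -ᵥ φ 0ᵥ                      ≡⟨ cong (λ x → φ x -ᵥ φ 0ᵥ) (+ᵥ-identityʳ u) ⟨
        φ (u +ᵥ 0ᵥ) -ᵥ φ 0ᵥ              ≡⟨ cong₂ _-ᵥ_ φu≡ φ0≡ ⟩
        (u′ +ᵥ a +ᵥ w₀) -ᵥ (a +ᵥ w₀)     ≡⟨ a+w-[b+w]≡a-b (u′ +ᵥ a) a w₀ ⟩
        u′ +ᵥ a -ᵥ a                     ≡⟨ u+v-v≡u u′ a ⟩
        u′                               ∎)

    ψ-component-reflect : ∀ i {u} → T (imageIndex i) (ψ u) → S i u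
    ψ-component-reflect i ψu∈ with v , v∈ , ψv≡ψu ← ψ-component-onto i ψu∈ = subst (S i) (ψ-injective ψv≡ψu) v∈

    private
      ψ-difference : ∀ u v → ψ u -ᵥ ψ v ≡ φ u -ᵥ φ v
      ψ-difference u v = cong₂ _,_ (lemma _ _ _) (lemma _ _ _)
        where
        lemma : ∀ a b w → (a - w) - (b - w) ≡ a - b
        lemma = solve 3 (λ a b w → (a :- w) :- (b :- w) := a :- b) refl

    -- Were the image directions of the parallel lines S i and S i + w
    -- different, their images would meet, so that w ∈ S i.
    ψ-parallel : ∀ i w {u} → S i u → T (imageIndex i) (ψ (u +ᵥ w) -ᵥ ψ w)
    ψ-parallel i w {u} u∈ = subst (T (imageIndex i)) (sym (ψ-difference (u +ᵥ w) w)) difference∈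
      where
      k : J
      k = proj₁ (proj₁ (φ-line (i , w)))
      meet⇒w∈ : Complementary (T (imageIndex i)) (T k) → S i w
      meet⇒w∈ (_ , split) with φ-line (i , 0ᵥ) | φ-line (i , w)
      ... | (j , w₀) , _ , ⊇₀ | (k , w₁) , _ , ⊇₁
        with p , r , p∈ , r∈ , w₁-w₀≡ ← split (w₁ -ᵥ w₀)
        with _ , (x , x∈ , refl) , φx≡ ← ⊇₀ (p , p∈ , refl)
           | _ , (y , y∈ , refl) , φy≡ ← ⊇₁ (0ᵥ -ᵥ r , T.-ᵥ-closed k (T.0∈ k) r∈ , refl) =
        subst (S i) x-y≡w (S.-ᵥ-closed i x∈ y∈)
        where
        p+w₀≡ : p +ᵥ w₀ ≡ (0ᵥ -ᵥ r) +ᵥ w₁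
        p+w₀≡ = cong₂ _,_ (lemma _ _ _ _ (cong proj₁ w₁-w₀≡)) (lemma _ _ _ _ (cong proj₂ w₁-w₀≡))
          where
          lemma : ∀ p w₀ r w₁ → w₁ - w₀ ≡ p + r → p + w₀ ≡ (0# - r) + w₁
          lemma p w₀ r w₁ eq = x-y≡0⇒x≡y (trans (solve 4 (λ p w₀ r w₁ → (p :+ w₀) :- ((:0 :- r) :+ w₁) := (p :+ r) :- (w₁ :- w₀)) refl p w₀ r w₁) (x≡y⇒x-y≡0 (sym eq)))
        x≡y+w : x ≡ y +ᵥ w
        x≡y+w = trans (sym (+ᵥ-identityʳ x)) (φ-injective (trans φx≡ (trans p+w₀≡ (sym φy≡))))
        x-y≡w : x -ᵥ y ≡ w
        x-y≡w = trans (cong (_-ᵥ y) (trans x≡y+w (+ᵥ-comm y w))) (u+v-v≡u w y)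
      difference∈ : T (imageIndex i) (φ (u +ᵥ w) -ᵥ φ w)
      difference∈ with T.dichotomy (imageIndex i) k
      ... | inj₁ (_ , k⊆) = k⊆ (subst (λ x → T k (φ (u +ᵥ w) -ᵥ φ x)) (+ᵥ-identityˡ w) (collinear-difference i w u∈ (S.0∈ i)))
      ... | inj₂ comp = let w∈ = meet⇒w∈ comp in component-difference i (S.+-closed i u∈ w∈) w∈

    private
      -- A parallelogram argument: ψ(u + v) - ψ v has the direction of the image of S i, and ψ(u +
      -- v) - ψ u that of the image of S k. The defect ψ(u + v) - ψ u - ψ v lies in both, and they
      -- meet in 0.
      ψ-+-complementary : ∀ {i k} → Complementary (S i) (S k) → ∀ {u v} → S i u → S k v → ψ (u +ᵥ v) ≡ ψ u +ᵥ ψ v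
      ψ-+-complementary {i} {k} (S-disjoint , S-split) {u} {v} u∈ v∈ with T.dichotomy (imageIndex i) (imageIndex k)
      -- If the images coincided, S i and S k would contain each other, so both components of (0 ,
      -- 1) would vanish.
      ... | inj₁ (i⊆k , k⊆i) with a , b , a∈ , b∈ , 0,1≡ ← S-split (0# , 1#) =
        contradiction (trans 0,1≡ (trans (cong₂ _+ᵥ_
          (S-disjoint a∈ (ψ-component-reflect k (i⊆k (ψ-component i a∈))))
          (S-disjoint (ψ-component-reflect i (k⊆i (ψ-component k b∈))) b∈)) (+ᵥ-identityʳ 0ᵥ))) 0,1≢0
      ... | inj₂ (T-disjoint , _) = defect≡0⇒ (T-disjoint
          (T.-ᵥ-closed (imageIndex i) (ψ-parallel i v u∈) (ψ-component i u∈))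
          (subst (T (imageIndex k)) defect≡ (T.-ᵥ-closed (imageIndex k) (ψ-parallel k u v∈) (ψ-component k v∈))))
        where
        defect≡ : ψ (v +ᵥ u) -ᵥ ψ u -ᵥ ψ v ≡ ψ (u +ᵥ v) -ᵥ ψ v -ᵥ ψ u
        defect≡ = trans (cong (λ x → ψ x -ᵥ ψ u -ᵥ ψ v) (+ᵥ-comm v u)) (cong₂ _,_ (lemma _ _ _) (lemma _ _ _))
          where
          lemma : ∀ a b c → (a - b) - c ≡ (a - c) - b
          lemma = solve 3 (λ a b c → (a :- b) :- c := (a :- c) :- b) refl
        defect≡0⇒ : ψ (u +ᵥ v) -ᵥ ψ v -ᵥ ψ u ≡ 0ᵥ → ψ (u +ᵥ v) ≡ ψ u +ᵥ ψ v
        defect≡0⇒ eq = trans (sym (u-v+v≡u (ψ (u +ᵥ v)) (ψ v))) (cong (_+ᵥ ψ v) (u-v≡0⇒u≡v eq))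

    -- When u and v share a member, a nonzero w of a complementary member serves as a detour: v + w
    -- leaves the common member, so (u + v) + w and u + (v + w) both split along complementary
    -- members, and ψ w cancels.
    ψ-+ : ∀ u v → ψ (u +ᵥ v) ≡ ψ u +ᵥ ψ v
    ψ-+ u v with i , u∈ ← S.cover u | k , v∈ ← S.cover v with S.dichotomy i k
    ... | inj₂ comp = ψ-+-complementary comp u∈ v∈
    ... | inj₁ (_ , k⊆i) with j , comp-ij@(disjoint , _) , w , w∈ , w≢0 ← S.complement i
      with l , v+w∈ ← S.cover (v +ᵥ w) with S.dichotomy i l
    ...   | inj₁ (_ , l⊆i) = contradiction (disjoint
              (subst (S i) (trans (cong (_-ᵥ v) (+ᵥ-comm v w)) (u+v-v≡u w v)) (S.-ᵥ-closed i (l⊆i v+w∈) (k⊆i v∈))) w∈) w≢0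
    ...   | inj₂ comp-il = +ᵥ-cancelʳ (ψ w) (begin
      ψ (u +ᵥ v) +ᵥ ψ w      ≡⟨ ψ-+-complementary comp-ij (S.+-closed i u∈ (k⊆i v∈)) w∈ ⟨
      ψ (u +ᵥ v +ᵥ w)        ≡⟨ cong ψ (+ᵥ-assoc u v w) ⟩
      ψ (u +ᵥ (v +ᵥ w))      ≡⟨ ψ-+-complementary comp-il u∈ v+w∈ ⟩
      ψ u +ᵥ ψ (v +ᵥ w)      ≡⟨ cong (ψ u +ᵥ_) (ψ-+-complementary comp-ij (k⊆i v∈) w∈) ⟩
      ψ u +ᵥ (ψ v +ᵥ ψ w)    ≡⟨ +ᵥ-assoc (ψ u) (ψ v) (ψ w) ⟨
      ψ u +ᵥ ψ v +ᵥ ψ w      ∎)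

  -- The spread ℬ_f

  module ScatteredSpread (f : LinearizedPolynomial) (f-linear : IsKLinear (eval f)) (f-scattered : IsScatteredPolynomial f) where

    private module f = IsKLinear f-linear

    proportional : ∀ {y z} → y ≢ 0# → z ≢ 0# → z * eval f y ≡ y * eval f z → ∃[ c ] z ≡ ι c * y
    proportional {y} {z} y≢0 z≢0 eq with a , b , a,b≢0 , ay+bz≡0 ← f-scattered y z (x≡y⇒x-y≡0 eq) with b K.≟ K.0#
    ... | yes refl = contradiction (decidable-stable (a K.≟ K.0#) (λ a≢0 → nonzero-* (ι-nonzero a≢0) y≢0 (begin
        ι a * y                  ≡⟨ solve 2 (λ x z → x := x :+ :0 :* z) refl (ι a * y) z ⟩
        ι a * y + 0# * z         ≡⟨ cong (λ w → ι a * y + w * z) ι-0 ⟨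
        ι a * y + ι K.0# * z     ≡⟨ ay+bz≡0 ⟩
        0#                       ∎)) , refl) a,b≢0
    ... | no b≢0 = K.- (b K.⁻¹ K.* a) , (*-cancelˡ (ι-nonzero b≢0) (x-y≡0⇒x≡y (begin
        ι b * z - ι b * (ι (K.- (b K.⁻¹ K.* a)) * y)   ≡⟨ cong (λ w → ι b * z - w) (sym (*-assoc _ _ _)) ⟩
        ι b * z - (ι b * ι (K.- (b K.⁻¹ K.* a))) * y   ≡⟨ cong (λ w → ι b * z - w * y) (trans (sym (ι-* b _)) (trans (cong ι b*-≡) (ι-neg a))) ⟩
        ι b * z - (- ι a) * y                          ≡⟨ solve 4 (λ b z a y → b :* z :- (:- a) :* y := a :* y :+ b :* z) refl (ι b) z (ι a) y ⟩
        ι a * y + ι b * z                              ≡⟨ ay+bz≡0 ⟩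
        0#                                             ∎)))
      where
      b*-≡ : b K.* (K.- (b K.⁻¹ K.* a)) ≡ K.- a
      b*-≡ = trans (K.solve 3 (λ b n a → b K.:* (K.:- (n K.:* a)) K.:= K.:- (b K.:* (n K.:* a))) refl b (b K.⁻¹) a)
                   (cong K.-_ (K.x*[x⁻¹*y]≡y b≢0 a))

    -- Every member is parametrised by 𝔽. This makes it decidable whether two members meet outside
    -- 0, and gives all members the same size q^t.
    member : SpreadIndex f → F → V
    member (slope m _)    x = x · (1# , m)
    member (multiple h _) x = h · (x , eval f x)
    member vertical       x = 0# , x

    member∈ : ∀ i x → spread f i (member i x)
    member∈ (slope m _)    x = x , refl
    member∈ (multiple h _) x = (x , eval f x) , (x , refl) , refl
    member∈ vertical       x = refl

    ∈⇒member : ∀ i {v} → spread f i v → ∃[ x ] v ≡ member i x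
    ∈⇒member (slope m _)    (x , eq)                  = x , eq
    ∈⇒member (multiple h _) (_ , (x , refl) , refl)   = x , refl
    ∈⇒member vertical       {_ , y} refl              = y , refl

    member-+ : ∀ i x y → member i (x + y) ≡ member i x +ᵥ member i y
    member-+ (slope m _)    x y = ·-distribʳ x y (1# , m)
    member-+ (multiple h _) x y = trans (cong (h ·_) (cong (x + y ,_) (f.+-homo x y))) (·-distribˡ h (x , eval f x) (y , eval f y))
    member-+ vertical       x y = cong (_, x + y) (sym (+-identityˡ 0#))

    member-difference : ∀ i x y → member i (x - y) ≡ member i x -ᵥ member i y
    member-difference (slope m _)    x y = cong₂ _,_ (lemma x y 1#) (lemma x y m)
      where
      lemma : ∀ x y m → (x - y) * m ≡ x * m - y * m
      lemma = solve 3 (λ x y m → (x :- y) :* m := x :* m :- y :* m) refl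
    member-difference (multiple h _) x y = cong₂ _,_ (lemma h x y) (trans (cong (h *_) (f.-‿homo x y)) (lemma h (eval f x) (eval f y)))
      where
      lemma : ∀ h x y → h * (x - y) ≡ h * x - h * y
      lemma = solve 3 (λ h x y → h :* (x :- y) := h :* x :- h :* y) refl
    member-difference vertical       x y = cong (_, x - y) (sym (-‿inverseʳ 0#))

    member-0 : ∀ i → member i 0# ≡ 0ᵥ
    member-0 i = trans (cong (member i) (sym (-‿inverseʳ 0#))) (trans (member-difference i 0# 0#) (-ᵥ-self (member i 0#)))

    member-zero : ∀ i {x} → member i x ≡ 0ᵥ → x ≡ 0#
    member-zero (slope m _)    {x} eq = trans (sym (*-identityʳ x)) (cong proj₁ eq)
    member-zero (multiple h h≢0)   eq = *-cancelˡ h≢0 (trans (cong proj₁ eq) (sym (zeroʳ h)))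
    member-zero vertical           eq = cong proj₂ eq

    slope∉multiple : ∀ {m h v} → ¬ Slopes f m → h ≢ 0# → v ≢ 0ᵥ → ⟨ 1# , m ⟩ v → ¬ image (h ·_) (graph f) v
    slope∉multiple {m} {h} m∉ h≢0 v≢0 (x , refl) (_ , (y , refl) , eq) =
      m∉ (y , y≢0 , (*-cancelˡ y≢0 (*-cancelˡ h≢0 (begin
        h * (y * m)                    ≡⟨ *-assoc h y m ⟨
        h * y * m                      ≡⟨ cong (_* m) (trans (cong proj₁ eq) (*-identityʳ x)) ⟩
        x * m                          ≡⟨ cong proj₂ eq ⟨
        h * eval f y                   ≡⟨ cong (h *_) (x*[x⁻¹*y]≡y y≢0 (eval f y)) ⟨
        h * (y * (y ⁻¹ * eval f y))    ≡⟨ cong (λ z → h * (y * z)) (*-comm (y ⁻¹) (eval f y)) ⟩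
        h * (y * (eval f y * y ⁻¹))    ∎))))
      where
      y≢0 : y ≢ 0#
      y≢0 refl = v≢0 (trans (sym eq) (trans (cong (λ z → h · (0# , z)) f.0-homo) (·-zeroʳ h)))

    slope∩vertical : ∀ {m v} → ⟨ 1# , m ⟩ v → proj₁ v ≡ 0# → v ≡ 0ᵥ
    slope∩vertical {m} (x , refl) x1≡0 = trans (cong (_· (1# , m)) (trans (sym (*-identityʳ x)) x1≡0)) (·-zeroˡ (1# , m))

    multiple∩vertical : ∀ {h v} → h ≢ 0# → image (h ·_) (graph f) v → proj₁ v ≡ 0# → v ≡ 0ᵥ
    multiple∩vertical {h} h≢0 (_ , (x , refl) , refl) hx≡0 =
      trans (cong (λ x → h · (x , eval f x)) (*-cancelˡ h≢0 (trans hx≡0 (sym (zeroʳ h)))))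
            (trans (cong (λ z → h · (0# , z)) f.0-homo) (·-zeroʳ h))

    multiple-⊆ : ∀ {h h′} c → h ≡ h′ * ι c → ∀ {w} → image (h ·_) (graph f) w → image (h′ ·_) (graph f) w
    multiple-⊆ {h′ = h′} c refl (_ , (x , refl) , refl) = _ , (ι c * x , refl) ,
      cong₂ _,_ (sym (*-assoc h′ (ι c) x)) (trans (cong (h′ *_) (f.·-homo c x)) (sym (*-assoc h′ (ι c) (eval f x))))

    -- The case with content is that of two multiples: h (y , f y) = h′ (z , f z) gives (y , f y)
    -- and (z , f z) the same slope, so z = c y with c in 𝔽_q because f is scattered, and then h =
    -- h′ c.
    meet⇒⊆ : ∀ i j {v} → v ≢ 0ᵥ → spread f i v → spread f j v → ∀ {w} → spread f i w → spread f j w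
    meet⇒⊆ (slope m m∉) (slope m′ m′∉) v≢0 (x , refl) (x′ , eq) w∈ = subst (λ m → ⟨ 1# , m ⟩ _) m≡m′ w∈
      where
      x≡x′ : x ≡ x′
      x≡x′ = *-cancelʳ 1≢0 (cong proj₁ eq)
      m≡m′ : m ≡ m′
      m≡m′ = *-cancelˡ (·-nonzeroˡ v≢0) (trans (cong proj₂ eq) (cong (_* m′) (sym x≡x′)))
    meet⇒⊆ (slope m m∉)     (multiple h h≢0) v≢0 i∋v j∋v w∈ = contradiction j∋v (slope∉multiple m∉ h≢0 v≢0 i∋v)
    meet⇒⊆ (slope m m∉)     vertical         v≢0 i∋v j∋v w∈ = contradiction (slope∩vertical i∋v j∋v) v≢0
    meet⇒⊆ (multiple h h≢0) (slope m m∉)     v≢0 i∋v j∋v w∈ = contradiction i∋v (slope∉multiple m∉ h≢0 v≢0 j∋v)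
    meet⇒⊆ (multiple h h≢0) (multiple h′ h′≢0) v≢0 (_ , (y , refl) , refl) (_ , (z , refl) , eq) w∈ =
      multiple-⊆ c (*-cancelʳ y≢0 (trans hy≡h′z (trans (cong (h′ *_) z≡cy) (sym (*-assoc h′ (ι c) y))))) w∈
      where
      hy≡h′z : h * y ≡ h′ * z
      hy≡h′z = sym (cong proj₁ eq)
      hfy≡h′fz : h * eval f y ≡ h′ * eval f z
      hfy≡h′fz = sym (cong proj₂ eq)
      y≢0 : y ≢ 0#
      y≢0 refl = v≢0 (member-0 (multiple h h≢0))
      z≢0 : z ≢ 0#
      z≢0 refl = v≢0 (trans (sym eq) (member-0 (multiple h′ h′≢0)))
      c-z≡cy : ∃[ c ] z ≡ ι c * y
      c-z≡cy = proportional y≢0 z≢0 (*-cancelˡ h≢0 (begin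
        h * (z * eval f y)      ≡⟨ solve 3 (λ h z w → h :* (z :* w) := z :* (h :* w)) refl h z (eval f y) ⟩
        z * (h * eval f y)      ≡⟨ cong (z *_) hfy≡h′fz ⟩
        z * (h′ * eval f z)     ≡⟨ solve 3 (λ h z w → z :* (h :* w) := (h :* z) :* w) refl h′ z (eval f z) ⟩
        h′ * z * eval f z       ≡⟨ cong (_* eval f z) hy≡h′z ⟨
        h * y * eval f z        ≡⟨ *-assoc h y (eval f z) ⟩
        h * (y * eval f z)      ∎))
      c = proj₁ c-z≡cy
      z≡cy = proj₂ c-z≡cy
    meet⇒⊆ (multiple h h≢0) vertical         v≢0 i∋v j∋v w∈ = contradiction (multiple∩vertical h≢0 i∋v j∋v) v≢0
    meet⇒⊆ vertical         (slope m m∉)     v≢0 i∋v j∋v w∈ = contradiction (slope∩vertical j∋v i∋v) v≢0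
    meet⇒⊆ vertical         (multiple h h≢0) v≢0 i∋v j∋v w∈ = contradiction (multiple∩vertical h≢0 j∋v i∋v) v≢0
    meet⇒⊆ vertical         vertical         v≢0 i∋v j∋v w∈ = w∈

    -- By counting: the sum map from 𝔽 × 𝔽 to V is injective when the members meet in 0, hence onto.
    disjoint⇒complementary : ∀ i j → (∀ {v} → spread f i v → spread f j v → v ≡ 0ᵥ) → Complementary (spread f i) (spread f j)
    disjoint⇒complementary i j disjoint = disjoint , λ v →
      let (x , y) , eq = pair-injective⇒onto {λ (x , y) → member i x +ᵥ member j y} injective v
      in member i x , member j y , member∈ i x , member∈ j y , sym eq
      where
      injective : Injective _≡_ _≡_ λ (x , y) → member i x +ᵥ member j y
      injective {x , y} {x′ , y′} eq = cong₂ _,_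
          (x-y≡0⇒x≡y (member-zero i (trans (member-difference i x x′) d≡0)))
          (sym (x-y≡0⇒x≡y (member-zero j (trans (member-difference j y′ y) (trans (sym d≡) d≡0)))))
        where
        d≡ : member i x -ᵥ member i x′ ≡ member j y′ -ᵥ member j y
        d≡ = cong₂ _,_ (lemma _ _ _ _ (cong proj₁ eq)) (lemma _ _ _ _ (cong proj₂ eq))
          where
          lemma : ∀ a b c d → a + b ≡ c + d → a - c ≡ d - b
          lemma a b c d eq = x-y≡0⇒x≡y (trans (solve 4 (λ a b c d → (a :- c) :- (d :- b) := (a :+ b) :- (c :+ d)) refl a b c d) (x≡y⇒x-y≡0 eq))
        d≡0 : member i x -ᵥ member i x′ ≡ 0ᵥ
        d≡0 = disjoint (subst (spread f i) (member-difference i x x′) (member∈ i (x - x′)))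
                       (subst (spread f j) (trans (member-difference j y′ y) (sym d≡)) (member∈ j (y′ - y)))

    spread-dichotomy : ∀ i j → spread f i ≐ spread f j ⊎ Complementary (spread f i) (spread f j)
    spread-dichotomy i j with ∃? (λ x → ¬? (x ≟ 0#) ×-dec ∃? (λ y → member i x ≟ᵥ member j y))
    ... | yes (x , x≢0 , y , eq) = inj₁ (meet⇒⊆ i j v≢0 (member∈ i x) j∋v , meet⇒⊆ j i v≢0 j∋v (member∈ i x))
      where
      v≢0 : member i x ≢ 0ᵥ
      v≢0 = x≢0 ∘ member-zero i
      j∋v : spread f j (member i x)
      j∋v = subst (spread f j) (sym eq) (member∈ j y)
    ... | no disjoint = inj₂ (disjoint⇒complementary i j λ {v} i∋v j∋v → decidable-stable (v ≟ᵥ 0ᵥ) λ v≢0 →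
      let x , v≡ = ∈⇒member i i∋v
          y , v≡′ = ∈⇒member j j∋v
      in disjoint (x , (λ x≡0 → v≢0 (trans v≡ (trans (cong (member i) x≡0) (member-0 i)))) , y , trans (sym v≡) v≡′))

    spread-cover : ∀ v → ∃[ i ] spread f i v
    spread-cover (x , y) with x ≟ 0#
    ... | yes x≡0 = vertical , x≡0
    ... | no x≢0 with ∃? (λ z → ¬? (z ≟ 0#) ×-dec (y * x ⁻¹ ≟ eval f z * z ⁻¹))
    ...   | no m∉ = slope (y * x ⁻¹) m∉ , x , cong₂ _,_ (sym (*-identityʳ x))
              (trans (sym (x*[x⁻¹*y]≡y x≢0 y)) (cong (x *_) (*-comm (x ⁻¹) y)))
    ...   | yes (z , z≢0 , eq) = multiple (x * z ⁻¹) (nonzero-* x≢0 (nonzero-⁻¹ z≢0)) , (z , eval f z) , (z , refl) ,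
      cong₂ _,_ (trans (*-assoc x (z ⁻¹) z) (trans (cong (x *_) (*-inverseˡ z≢0)) (*-identityʳ x)))
                (begin
                  x * z ⁻¹ * eval f z     ≡⟨ solve 3 (λ x n w → x :* n :* w := x :* (w :* n)) refl x (z ⁻¹) (eval f z) ⟩
                  x * (eval f z * z ⁻¹)   ≡⟨ cong (x *_) eq ⟨
                  x * (y * x ⁻¹)          ≡⟨ cong (x *_) (*-comm y (x ⁻¹)) ⟩
                  x * (x ⁻¹ * y)          ≡⟨ x*[x⁻¹*y]≡y x≢0 y ⟩
                  y                       ∎)

    -- The vertical line complements every member other than itself, and U_f complements the
    -- vertical line.
    spread-complement : ∀ i → ∃[ j ] (Complementary (spread f i) (spread f j) × ∃[ w ] (spread f j w × w ≢ 0ᵥ))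
    spread-complement i with spread-dichotomy i vertical
    ... | inj₂ comp = vertical , comp , (0# , 1#) , refl , 0,1≢0
    ... | inj₁ (i⊆ , _) = multiple 1# 1≢0 ,
      disjoint⇒complementary i (multiple 1# 1≢0) (λ i∋v j∋v → multiple∩vertical 1≢0 j∋v (i⊆ i∋v)) ,
      member (multiple 1# 1≢0) 1# , member∈ (multiple 1# 1≢0) 1# , 1≢0 ∘ member-zero (multiple 1# 1≢0)

    spread-isSpread : IsSpread (spread f)
    spread-isSpread = record
      { 0∈ = λ i → subst (spread f i) (member-0 i) (member∈ i 0#)
      ; +-closed = λ i u∈ v∈ → let x , u≡ = ∈⇒member i u∈ ; y , v≡ = ∈⇒member i v∈ in
          subst (spread f i) (trans (member-+ i x y) (sym (cong₂ _+ᵥ_ u≡ v≡))) (member∈ i (x + y))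
      ; -ᵥ-closed = λ i u∈ v∈ → let x , u≡ = ∈⇒member i u∈ ; y , v≡ = ∈⇒member i v∈ in
          subst (spread f i) (trans (member-difference i x y) (sym (cong₂ _-ᵥ_ u≡ v≡))) (member∈ i (x - y))
      ; cover = spread-cover ; dichotomy = spread-dichotomy ; complement = spread-complement }

-- Semilinearity from many lines

module SemilinearTheory {q t : ℕ} (q-primePower : IsPrimePower q) (1<q : 1 < q) (E : FieldExtension q t) where
  open SpreadTheory q-primePower 1<q E public
  open ≡-Reasoning

  module AdditiveMap (ψ : V → V) (ψ-+ : ∀ u v → ψ (u +ᵥ v) ≡ ψ u +ᵥ ψ v) (ψ-0 : ψ 0ᵥ ≡ 0ᵥ) (ψ-injective : Injective _≡_ _≡_ ψ) where

    ψ-nonzero : ∀ {v} → v ≢ 0ᵥ → ψ v ≢ 0ᵥ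
    ψ-nonzero v≢0 ψv≡0 = v≢0 (ψ-injective (trans ψv≡0 (sym ψ-0)))

    MapsToLine : V → Set
    MapsToLine v = ∀ x → ∃[ y ] ψ (x · v) ≡ y · ψ v

    -- The property belongs to the line and not to its generator; this allows passing from (1 , m)
    -- to e₀ + k e₁.
    mapsToLine-multiple : ∀ {c v} → c ≢ 0# → v ≢ 0ᵥ → MapsToLine v → MapsToLine (c · v)
    mapsToLine-multiple {c} {v} c≢0 v≢0 line x with y , ψxcv≡ ← line (x * c) | z , ψcv≡ ← line c = y * z ⁻¹ , (begin
      ψ (x · c · v)           ≡⟨ cong ψ (·-assoc x c v) ⟨
      ψ ((x * c) · v)         ≡⟨ ψxcv≡ ⟩
      y · ψ v                 ≡⟨ cong (y ·_) (x⁻¹·x·v≡v z≢0 (ψ v)) ⟨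
      y · z ⁻¹ · z · ψ v      ≡⟨ ·-assoc y (z ⁻¹) (z · ψ v) ⟨
      (y * z ⁻¹) · z · ψ v    ≡⟨ cong ((y * z ⁻¹) ·_) ψcv≡ ⟨
      (y * z ⁻¹) · ψ (c · v)  ∎)
      where
      z≢0 : z ≢ 0#
      z≢0 = ·-nonzeroˡ (subst (_≢ 0ᵥ) ψcv≡ (ψ-nonzero (·-nonzero c≢0 v≢0)))

    module LineCoordinate {e : V} (e≢0 : e ≢ 0ᵥ) (line : MapsToLine e) where
      u : V
      u = ψ e

      u≢0 : u ≢ 0ᵥ
      u≢0 = ψ-nonzero e≢0

      A : F → F
      A = proj₁ ∘ line

      ψ-line : ∀ x → ψ (x · e) ≡ A x · u
      ψ-line = proj₂ ∘ line

      A-+ : ∀ x y → A (x + y) ≡ A x + A y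
      A-+ x y = ·-cancelʳ u≢0 (begin
        A (x + y) · u            ≡⟨ ψ-line (x + y) ⟨
        ψ ((x + y) · e)          ≡⟨ cong ψ (·-distribʳ x y e) ⟩
        ψ (x · e +ᵥ y · e)       ≡⟨ ψ-+ (x · e) (y · e) ⟩
        ψ (x · e) +ᵥ ψ (y · e)   ≡⟨ cong₂ _+ᵥ_ (ψ-line x) (ψ-line y) ⟩
        A x · u +ᵥ A y · u       ≡⟨ ·-distribʳ (A x) (A y) u ⟨
        (A x + A y) · u          ∎)

      A-1 : A 1# ≡ 1#
      A-1 = ·-cancelʳ u≢0 (trans (sym (ψ-line 1#)) (trans (cong ψ (·-identity e)) (sym (·-identity u))))

      A-0 : A 0# ≡ 0#
      A-0 = +-cancelʳ (trans (sym (A-+ 0# 0#)) (trans (cong A (+-identityʳ 0#)) (sym (+-identityˡ _))))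

      A-injective : Injective _≡_ _≡_ A
      A-injective {x} {y} eq = ·-cancelʳ e≢0 (ψ-injective (trans (ψ-line x) (trans (cong (_· u) eq) (sym (ψ-line y)))))

      A-onto : ∀ y → ∃[ x ] A x ≡ y
      A-onto = endo-injective⇒onto A-injective

      A-nonzero : ∀ {x} → x ≢ 0# → A x ≢ 0#
      A-nonzero x≢0 Ax≡0 = x≢0 (A-injective (trans Ax≡0 (sym A-0)))

      A-neg : ∀ x → A (- x) ≡ - A x
      A-neg x = +-cancelʳ {A x} (begin
        A (- x) + A x   ≡⟨ A-+ (- x) x ⟨
        A (- x + x)     ≡⟨ cong A (-‿inverseˡ x) ⟩
        A 0#            ≡⟨ A-0 ⟩
        0#              ≡⟨ -‿inverseˡ (A x) ⟨
        - A x + A x     ∎)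

      A-difference : ∀ x y → A (x - y) ≡ A x - A y
      A-difference x y = trans (A-+ x (- y)) (cong (A x +_) (A-neg y))

    -- The slopes m i give vectors proportional to e₀ + k i · e₁, on which ψ
    -- forces B (k i * x) = B (k i) * A x, where A and B are the coordinates of
    -- ψ on the lines of e₀ and e₁. Dividing by k 1, A is multiplicative at more
    -- than √q^t elements; these lie in no proper subfield, so everywhere.
    module ManyLines {n : ℕ} (m : Fin (3 ℕ.+ n) → F) (m-injective : Injective _≡_ _≡_ m)
      (lines : ∀ i → MapsToLine (1# , m i)) (many : q ℕ.^ t < (2 ℕ.+ n) ℕ.* (2 ℕ.+ n)) where

      m₀ m₁ D : F
      m₀ = m (suc zero)
      m₁ = m zero
      D  = m₁ - m₀

      e₀ e₁ : V
      e₀ = 1# , m₀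
      e₁ = 1# , m₁

      D≢0 : D ≢ 0#
      D≢0 = nonzero-difference λ eq → contradiction (m-injective eq) λ ()

      module L₀ = LineCoordinate {e₀} 1,m≢0 (lines (suc zero))
      module L₁ = LineCoordinate {e₁} 1,m≢0 (lines zero)
      open L₀ using (A; A-+; A-1; A-0; A-injective; A-onto; A-nonzero; A-difference; A-neg) renaming (u to u₀)
      open L₁ using () renaming (A to B; A-1 to B-1; A-onto to B-onto; A-nonzero to B-nonzero; u to u₁; u≢0 to u₁≢0)

      independent-images : ∀ {x y} → A x · u₀ ≡ B y · u₁ → A x ≡ 0# × B y ≡ 0#
      independent-images {x} {y} eq =
        Ax≡0 , ·-cancelʳ u₁≢0 (trans (sym eq) (trans (cong (_· u₀) Ax≡0) (trans (·-zeroˡ u₀) (sym (·-zeroˡ u₁)))))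
        where
        xe₀≡ye₁ : x · e₀ ≡ y · e₁
        xe₀≡ye₁ = ψ-injective (trans (L₀.ψ-line x) (trans eq (sym (L₁.ψ-line y))))
        x≡y : x ≡ y
        x≡y = *-cancelʳ 1≢0 (cong proj₁ xe₀≡ye₁)
        x≡0 : x ≡ 0#
        x≡0 = decidable-stable (x ≟ 0#) λ x≢0 → D≢0 (x≡y⇒x-y≡0 (sym (*-cancelˡ x≢0
          (trans (cong proj₂ xe₀≡ye₁) (cong (_* m₁) (sym x≡y))))))
        Ax≡0 : A x ≡ 0#
        Ax≡0 = trans (cong A x≡0) A-0

      -- Since A and B are onto, any such relation is an equation ψ(x′ e₀) = ψ(y′ e₁), and e₀, e₁
      -- have different slopes.
      independent : ∀ {x y} → x · u₀ ≡ y · u₁ → x ≡ 0# × y ≡ 0#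
      independent {x} {y} eq =
        let x′ , Ax′≡x = A-onto x
            y′ , By′≡y = B-onto y
            Ax′≡0 , By′≡0 = independent-images {x′} {y′} (trans (cong (_· u₀) Ax′≡x) (trans eq (cong (_· u₁) (sym By′≡y))))
        in trans (sym Ax′≡x) Ax′≡0 , trans (sym By′≡y) By′≡0

      coordinates-unique : ∀ {a b c d} → a · u₀ +ᵥ b · u₁ ≡ c · u₀ +ᵥ d · u₁ → a ≡ c × b ≡ d
      coordinates-unique {a} {b} {c} {d} eq = let a-c≡0 , d-b≡0 = independent {a - c} {d - b} (cong₂ _,_ (lemma (proj₁ u₀) (proj₁ u₁) (cong proj₁ eq)) (lemma (proj₂ u₀) (proj₂ u₁) (cong proj₂ eq)))
        in x-y≡0⇒x≡y a-c≡0 , sym (x-y≡0⇒x≡y d-b≡0)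
        where
        lemma : ∀ u v → a * u + b * v ≡ c * u + d * v → (a - c) * u ≡ (d - b) * v
        lemma u v eq = x-y≡0⇒x≡y (trans
          (solve 6 (λ a b c d u v → (a :- c) :* u :- (d :- b) :* v := (a :* u :+ b :* v) :- (c :* u :+ d :* v)) refl a b c d u v)
          (x≡y⇒x-y≡0 eq))

      ψ-coordinates : ∀ x y → ψ (x · e₀ +ᵥ y · e₁) ≡ A x · u₀ +ᵥ B y · u₁
      ψ-coordinates x y = trans (ψ-+ (x · e₀) (y · e₁)) (cong₂ _+ᵥ_ (L₀.ψ-line x) (L₁.ψ-line y))

      gap : Fin (2 ℕ.+ n) → F
      gap i = m₁ - m (suc i)

      gap≢0 : ∀ i → gap i ≢ 0#
      gap≢0 i = nonzero-difference λ eq → contradiction (m-injective eq) λ ()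

      -- The affine parameter on the projective line in which e₀ is 0 and e₁ is infinity: 3 + n
      -- slopes leave 2 + n finite parameters, among them 0 at index `zero`.
      k : Fin (2 ℕ.+ n) → F
      k i = (m (suc i) - m₀) * gap i ⁻¹

      1+k≡ : ∀ i → 1# + k i ≡ D * gap i ⁻¹
      1+k≡ i = begin
        1# + k i                      ≡⟨ cong (_+ k i) (*-inverseʳ (gap i) (gap≢0 i)) ⟨
        gap i * gap i ⁻¹ + k i        ≡⟨ solve 4 (λ m m₀ m₁ w → (m₁ :- m) :* w :+ (m :- m₀) :* w := (m₁ :- m₀) :* w) refl (m (suc i)) m₀ m₁ (gap i ⁻¹) ⟩
        D * gap i ⁻¹                  ∎

      k-direction : ∀ i → (D * gap i ⁻¹) · (1# , m (suc i)) ≡ e₀ +ᵥ k i · e₁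
      k-direction i = cong₂ _,_
        (trans (*-identityʳ (D * gap i ⁻¹)) (trans (sym (1+k≡ i)) (cong (1# +_) (sym (*-identityʳ (k i))))))
        (begin
          D * gap i ⁻¹ * m (suc i)        ≡⟨ solve 4 (λ m m₀ m₁ w → (m₁ :- m₀) :* w :* m := ((m₁ :- m) :* w) :* m₀ :+ (m :- m₀) :* w :* m₁) refl (m (suc i)) m₀ m₁ (gap i ⁻¹) ⟩
          gap i * gap i ⁻¹ * m₀ + k i * m₁ ≡⟨ cong (λ z → z * m₀ + k i * m₁) (*-inverseʳ (gap i) (gap≢0 i)) ⟩
          1# * m₀ + k i * m₁              ≡⟨ cong (_+ k i * m₁) (*-identityˡ m₀) ⟩
          m₀ + k i * m₁                   ∎)

      k-injective : Injective _≡_ _≡_ k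
      k-injective {i} {j} eq = suc-injective (m-injective (sym (x-y≡0⇒x≡y (begin
          m (suc j) - m (suc i)     ≡⟨ solve 3 (λ m₁ a b → b :- a := (m₁ :- a) :- (m₁ :- b)) refl m₁ (m (suc i)) (m (suc j)) ⟩
          gap i - gap j             ≡⟨ x≡y⇒x-y≡0 gapᵢ≡gapⱼ ⟩
          0#                        ∎))))
        where
        inverses≡ : gap i ⁻¹ ≡ gap j ⁻¹
        inverses≡ = *-cancelˡ D≢0 (trans (sym (1+k≡ i)) (trans (cong (1# +_) eq) (1+k≡ j)))
        gapᵢ≡gapⱼ : gap i ≡ gap j
        gapᵢ≡gapⱼ = *-cancelʳ (nonzero-⁻¹ (gap≢0 j)) (trans (cong (gap i *_) (sym inverses≡))
          (trans (*-inverseʳ (gap i) (gap≢0 i)) (sym (*-inverseʳ (gap j) (gap≢0 j)))))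

      k-line : ∀ i → MapsToLine (e₀ +ᵥ k i · e₁)
      k-line i = subst MapsToLine (k-direction i)
        (mapsToLine-multiple (nonzero-* D≢0 (nonzero-⁻¹ (gap≢0 i))) 1,m≢0 (lines (suc i)))

      B-k : ∀ i x → B (k i * x) ≡ B (k i) * A x
      B-k i x = trans (proj₂ unique) (trans (cong (_* B (k i)) (sym (proj₁ unique))) (*-comm (A x) (B (k i))))
        where
        y : F
        y = proj₁ (k-line i x)
        unique : A x ≡ y × B (k i * x) ≡ y * B (k i)
        unique = coordinates-unique (begin
          A x · u₀ +ᵥ B (k i * x) · u₁           ≡⟨ ψ-coordinates x (k i * x) ⟨
          ψ (x · e₀ +ᵥ (k i * x) · e₁)           ≡⟨ cong (λ v → ψ (x · e₀ +ᵥ v)) (trans (cong (_· e₁) (*-comm (k i) x)) (·-assoc x (k i) e₁)) ⟩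
          ψ (x · e₀ +ᵥ x · k i · e₁)             ≡⟨ cong ψ (·-distribˡ x e₀ (k i · e₁)) ⟨
          ψ (x · (e₀ +ᵥ k i · e₁))               ≡⟨ proj₂ (k-line i x) ⟩
          y · ψ (e₀ +ᵥ k i · e₁)                 ≡⟨ cong (y ·_) (trans (cong (λ v → ψ (v +ᵥ k i · e₁)) (sym (·-identity e₀))) (ψ-coordinates 1# (k i))) ⟩
          y · (A 1# · u₀ +ᵥ B (k i) · u₁)        ≡⟨ cong (λ z → y · (z +ᵥ B (k i) · u₁)) (trans (cong (_· u₀) A-1) (·-identity u₀)) ⟩
          y · (u₀ +ᵥ B (k i) · u₁)               ≡⟨ ·-distribˡ y u₀ (B (k i) · u₁) ⟩
          y · u₀ +ᵥ y · B (k i) · u₁             ≡⟨ cong (y · u₀ +ᵥ_) (·-assoc y (B (k i)) u₁) ⟨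
          y · u₀ +ᵥ (y * B (k i)) · u₁           ∎)

      k₁ : F
      k₁ = k (suc zero)

      k₁≢0 : k₁ ≢ 0#
      k₁≢0 eq = contradiction (k-injective {suc zero} {zero} (trans eq (sym k₀≡0))) λ ()
        where
        k₀≡0 : k zero ≡ 0#
        k₀≡0 = trans (cong (_* gap zero ⁻¹) (-‿inverseʳ m₀)) (zeroˡ _)

      l : Fin (2 ℕ.+ n) → F
      l i = k₁ ⁻¹ * k i

      l-injective : Injective _≡_ _≡_ l
      l-injective = k-injective ∘ *-cancelˡ (nonzero-⁻¹ k₁≢0)

      Multiplicative : F → Set
      Multiplicative a = ∀ x → A (a * x) ≡ A a * A x

      -- B at k i · x = k₁ · (l i · x) is computed in two ways, once through k i and once through
      -- k₁; the case x = 1 relates B (k i) to A (l i).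
      l-multiplicative : ∀ i → Multiplicative (l i)
      l-multiplicative i x = *-cancelˡ (B-nonzero k₁≢0) (begin
        B k₁ * A (l i * x)             ≡⟨ B-k (suc zero) (l i * x) ⟨
        B (k₁ * (l i * x))             ≡⟨ cong B (trans (sym (*-assoc k₁ (l i) x)) (cong (_* x) (x*[x⁻¹*y]≡y k₁≢0 (k i)))) ⟩
        B (k i * x)                    ≡⟨ B-k i x ⟩
        B (k i) * A x                  ≡⟨ cong (λ z → B z * A x) (x*[x⁻¹*y]≡y k₁≢0 (k i)) ⟨
        B (k₁ * l i) * A x             ≡⟨ cong (_* A x) (B-k (suc zero) (l i)) ⟩
        B k₁ * A (l i) * A x           ≡⟨ *-assoc (B k₁) (A (l i)) (A x) ⟩
        B k₁ * (A (l i) * A x)         ∎)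

      difference-multiplicative : ∀ {a b} → Multiplicative a → Multiplicative b → Multiplicative (a - b)
      difference-multiplicative {a} {b} a-mult b-mult x = begin
        A ((a - b) * x)          ≡⟨ cong A (solve 3 (λ a b x → (a :- b) :* x := a :* x :- b :* x) refl a b x) ⟩
        A (a * x - b * x)        ≡⟨ A-difference (a * x) (b * x) ⟩
        A (a * x) - A (b * x)    ≡⟨ cong₂ _-_ (a-mult x) (b-mult x) ⟩
        A a * A x - A b * A x    ≡⟨ solve 3 (λ a b x → a :* x :- b :* x := (a :- b) :* x) refl (A a) (A b) (A x) ⟩
        (A a - A b) * A x        ≡⟨ cong (_* A x) (A-difference a b) ⟨
        A (a - b) * A x          ∎

      quotient-multiplicative : ∀ {d ω} → d ≢ 0# → Multiplicative d → Multiplicative (d * ω) → Multiplicative ω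
      quotient-multiplicative {d} {ω} d≢0 d-mult dω-mult x = *-cancelˡ (A-nonzero d≢0) (begin
        A d * A (ω * x)      ≡⟨ d-mult (ω * x) ⟨
        A (d * (ω * x))      ≡⟨ cong A (*-assoc d ω x) ⟨
        A (d * ω * x)        ≡⟨ dω-mult x ⟩
        A (d * ω) * A x      ≡⟨ cong (_* A x) (d-mult ω) ⟩
        A d * A ω * A x      ≡⟨ *-assoc (A d) (A ω) (A x) ⟩
        A d * (A ω * A x)    ∎)

      -- There are more pairs (i , j) than field elements, so two of the sums l i + l j ω coincide.
      -- This exhibits ω as a quotient of differences of the l's, and multiplicativity passes to
      -- differences and quotients. Equal l j would force equal l i, so the denominator is nonzero.
      A-* : ∀ ω → Multiplicative ω
      A-* ω = from-collision (pigeonhole many (λ p → let i , j = remQuot (2 ℕ.+ n) p in index (l i + l j * ω)))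
        where
        from-collision : (∃₂ λ p p′ → p Fin.< p′ × index (l (proj₁ (remQuot (2 ℕ.+ n) p)) + l (proj₂ (remQuot {2 ℕ.+ n} (2 ℕ.+ n) p)) * ω)
                                       ≡ index (l (proj₁ (remQuot (2 ℕ.+ n) p′)) + l (proj₂ (remQuot {2 ℕ.+ n} (2 ℕ.+ n) p′)) * ω)) →
                         Multiplicative ω
        from-collision (p , p′ , p<p′ , eq) = quotient-multiplicative d≢0
            (difference-multiplicative (l-multiplicative j) (l-multiplicative j′))
            (subst Multiplicative (sym dω≡) (difference-multiplicative (l-multiplicative i′) (l-multiplicative i)))
          where
          i i′ j j′ : Fin (2 ℕ.+ n)
          i  = proj₁ (remQuot (2 ℕ.+ n) p)
          j  = proj₂ (remQuot {2 ℕ.+ n} (2 ℕ.+ n) p)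
          i′ = proj₁ (remQuot (2 ℕ.+ n) p′)
          j′ = proj₂ (remQuot {2 ℕ.+ n} (2 ℕ.+ n) p′)
          collision : l i + l j * ω ≡ l i′ + l j′ * ω
          collision = index-injective eq
          dω≡ : (l j - l j′) * ω ≡ l i′ - l i
          dω≡ = x-y≡0⇒x≡y (trans (solve 5 (λ a b c d w → (b :- d) :* w :- (c :- a) := (a :+ b :* w) :- (c :+ d :* w)) refl (l i) (l j) (l i′) (l j′) ω)
                                 (x≡y⇒x-y≡0 collision))
          d≢0 : l j - l j′ ≢ 0#
          d≢0 d≡0 = <⇒≢ p<p′ (begin
            p               ≡⟨ combine-remQuot {2 ℕ.+ n} (2 ℕ.+ n) p ⟨
            combine i j     ≡⟨ cong₂ combine i≡i′ j≡j′ ⟩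
            combine i′ j′   ≡⟨ combine-remQuot {2 ℕ.+ n} (2 ℕ.+ n) p′ ⟩
            p′              ∎)
            where
            j≡j′ : j ≡ j′
            j≡j′ = l-injective (x-y≡0⇒x≡y d≡0)
            i≡i′ : i ≡ i′
            i≡i′ = l-injective (+-cancelʳ (trans collision (cong (λ z → l i′ + l z * ω) (sym j≡j′))))

      -- Multiplicativity of A turns `B-k` into B = c A for a constant c, and both maps take 1 to 1.
      B≡A : ∀ y → B y ≡ A y
      B≡A y = trans (B≡c*A y) (trans (cong (_* A y) c≡1) (*-identityˡ (A y)))
        where
        c : F
        c = B k₁ * A (k₁ ⁻¹)
        B≡c*A : ∀ y → B y ≡ c * A y
        B≡c*A y = begin
          B y                             ≡⟨ cong B (x*[x⁻¹*y]≡y k₁≢0 y) ⟨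
          B (k₁ * (k₁ ⁻¹ * y))            ≡⟨ B-k (suc zero) (k₁ ⁻¹ * y) ⟩
          B k₁ * A (k₁ ⁻¹ * y)            ≡⟨ cong (B k₁ *_) (A-* (k₁ ⁻¹) y) ⟩
          B k₁ * (A (k₁ ⁻¹) * A y)        ≡⟨ *-assoc (B k₁) (A (k₁ ⁻¹)) (A y) ⟨
          c * A y                         ∎
        c≡1 : c ≡ 1#
        c≡1 = begin
          c              ≡⟨ *-identityʳ c ⟨
          c * 1#         ≡⟨ cong (c *_) A-1 ⟨
          c * A 1#       ≡⟨ B≡c*A 1# ⟨
          B 1#           ≡⟨ B-1 ⟩
          1#             ∎

      spanning : ∀ v → ∃₂ λ a b → v ≡ a · e₀ +ᵥ b · e₁
      spanning (x , y) = x - b , b , cong₂ _,_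
          (solve 2 (λ x b → x := (x :- b) :* :1 :+ b :* :1) refl x b)
          (x-y≡0⇒x≡y (begin
            y - ((x - b) * m₀ + b * m₁)   ≡⟨ solve 5 (λ x y b m₀ m₁ → y :- ((x :- b) :* m₀ :+ b :* m₁) := (y :- m₀ :* x) :- (m₁ :- m₀) :* b) refl x y b m₀ m₁ ⟩
            (y - m₀ * x) - D * b          ≡⟨ x≡y⇒x-y≡0 (sym (x*[x⁻¹*y]≡y D≢0 (y - m₀ * x))) ⟩
            0#                            ∎))
        where
        b : F
        b = D ⁻¹ * (y - m₀ * x)

      ψ-· : ∀ x v → ψ (x · v) ≡ A x · ψ v
      ψ-· x v = let a , b , v≡ = spanning v in subst (λ v → ψ (x · v) ≡ A x · ψ v) (sym v≡) (on-coordinates a b)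
        where
        on-coordinates : ∀ a b → ψ (x · (a · e₀ +ᵥ b · e₁)) ≡ A x · ψ (a · e₀ +ᵥ b · e₁)
        on-coordinates a b = begin
          ψ (x · (a · e₀ +ᵥ b · e₁))             ≡⟨ cong ψ (trans (·-distribˡ x (a · e₀) (b · e₁)) (sym (cong₂ _+ᵥ_ (·-assoc x a e₀) (·-assoc x b e₁)))) ⟩
          ψ ((x * a) · e₀ +ᵥ (x * b) · e₁)       ≡⟨ ψ-coordinates (x * a) (x * b) ⟩
          A (x * a) · u₀ +ᵥ B (x * b) · u₁       ≡⟨ cong₂ (λ z w → z · u₀ +ᵥ w · u₁) (A-* x a) (trans (B≡A (x * b)) (trans (A-* x b) (cong (A x *_) (sym (B≡A b))))) ⟩
          (A x * A a) · u₀ +ᵥ (A x * B b) · u₁   ≡⟨ cong₂ _+ᵥ_ (·-assoc (A x) (A a) u₀) (·-assoc (A x) (B b) u₁) ⟩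
          A x · A a · u₀ +ᵥ A x · B b · u₁       ≡⟨ ·-distribˡ (A x) (A a · u₀) (B b · u₁) ⟨
          A x · (A a · u₀ +ᵥ B b · u₁)           ≡⟨ cong (A x ·_) (ψ-coordinates a b) ⟨
          A x · ψ (a · e₀ +ᵥ b · e₁)             ∎

      A-automorphism : IsRingIsomorphism rawRing rawRing A
      A-automorphism = record
        { isRingMonomorphism = record
          { isRingHomomorphism = record
            { isSemiringHomomorphism = record
              { isNearSemiringHomomorphism = record
                { +-isMonoidHomomorphism = record
                  { isMagmaHomomorphism = record { isRelHomomorphism = record { cong = cong A } ; homo = A-+ }
                  ; ε-homo = A-0 }
                ; *-homo = A-* }
              ; 1#-homo = A-1 }
            ; -‿homo = A-neg }
          ; injective = A-injective }
        ; surjective = λ y → let x , Ax≡y = A-onto y in x , λ { refl → Ax≡y } }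

-- Counting slopes

Embedding : ∀ {n} → ℕ → (Fin n → Set) → Set
Embedding {n} a P = Σ (Fin a → Fin n) λ g → Injective _≡_ _≡_ g × (∀ i → P (g i))

-- Applied twice: the field is split into L_f and the rest, and the rest into bad and good slopes.
-- The enumerations may be refined further because they are injective.
partition : ∀ {n} {P Q : Fin n → Set} → (∀ i → P i ⊎ Q i) →
            ∃₂ λ a b → a ℕ.+ b ≡ n × Embedding a P × Embedding b Q
partition {zero} P⊎Q = 0 , 0 , refl , ((λ ()) , (λ { {()} }) , λ ()) , ((λ ()) , (λ { {()} }) , λ ())
partition {suc n} {P} {Q} P⊎Q =
  let a , b , a+b≡n , P↪ , Q↪ = partition (P⊎Q ∘ suc) in
  [ (λ p → suc a , b , cong suc a+b≡n , cons P p P↪ , weaken Q Q↪)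
  , (λ q → a , suc b , trans (ℕₚ.+-suc a b) (cong suc a+b≡n) , weaken P P↪ , cons Q q Q↪) ]′ (P⊎Q zero)
  where
  weaken : ∀ (R : Fin (suc n) → Set) {c} → Embedding c (R ∘ suc) → Embedding c R
  weaken R (g , g-injective , r) = suc ∘ g , g-injective ∘ suc-injective , r
  cons : ∀ (R : Fin (suc n) → Set) {c} → R zero → Embedding c (R ∘ suc) → Embedding (suc c) R
  cons R r₀ (g , g-injective , r) =
    (λ { zero → zero ; (suc i) → suc (g i) }) ,
    (λ { {zero} {zero} _ → refl ; {suc i} {suc j} eq → cong suc (g-injective (suc-injective eq)) }) ,
    λ { zero → r₀ ; (suc i) → r i }

module Counting {q t N : ℕ} (3<q : 3 < q) (1<t : 1 < t) (count : suc (N ℕ.* (q ∸ 1)) ≡ q ℕ.^ t) where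
  open ℕₚ.≤-Reasoning

  -- The constant 3 is 2 + 1: two exceptional sets of size at most N and N further elements, plus
  -- one since q^t = 1 + N(q - 1) ≥ 1 + 3N.
  many-remain : ∀ {a b c} → a ℕ.+ (b ℕ.+ c) ≡ q ℕ.^ t → a ≤ N → b ≤ N → suc N ≤ c
  many-remain {a} {b} {c} total a≤N b≤N = ℕₚ.+-cancelˡ-≤ N _ _ (ℕₚ.+-cancelˡ-≤ N _ _ (begin
    N ℕ.+ (N ℕ.+ suc N)       ≡⟨ cong (N ℕ.+_) (ℕₚ.+-suc N N) ⟩
    N ℕ.+ suc (N ℕ.+ N)       ≡⟨ ℕₚ.+-suc N (N ℕ.+ N) ⟩
    suc (N ℕ.+ (N ℕ.+ N))     ≡⟨ cong (λ x → suc (N ℕ.+ (N ℕ.+ x))) (ℕₚ.+-identityʳ N) ⟨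
    suc (3 ℕ.* N)             ≡⟨ cong suc (ℕₚ.*-comm 3 N) ⟩
    suc (N ℕ.* 3)             ≤⟨ s≤s (ℕₚ.*-monoʳ-≤ N (ℕₚ.∸-monoˡ-≤ 1 3<q)) ⟩
    suc (N ℕ.* (q ∸ 1))       ≡⟨ trans count (sym total) ⟩
    a ℕ.+ (b ℕ.+ c)           ≤⟨ ℕₚ.+-mono-≤ a≤N (ℕₚ.+-monoˡ-≤ c b≤N) ⟩
    N ℕ.+ (N ℕ.+ c)           ∎))

  q≤q^[t-1] : q ≤ q ℕ.^ (t ∸ 1)
  q≤q^[t-1] = begin
    q                ≡⟨ ℕₚ.^-identityʳ q ⟨
    q ℕ.^ 1          ≤⟨ ℕₚ.^-monoʳ-≤ q {{ℕ.>-nonZero (ℕₚ.<-trans (s≤s z≤n) 3<q)}} (ℕₚ.∸-monoˡ-≤ 1 1<t) ⟩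
    q ℕ.^ (t ∸ 1)    ∎

  q^t≡ : q ℕ.^ t ≡ q ℕ.* q ℕ.^ (t ∸ 1)
  q^t≡ = cong (q ℕ.^_) (sym (ℕₚ.m+[n∸m]≡n {1} (ℕₚ.<⇒≤ 1<t)))

  q≡ : q ≡ suc (q ∸ 1)
  q≡ = sym (ℕₚ.m+[n∸m]≡n {1} (ℕₚ.≤-trans (s≤s z≤n) 3<q))

  -- For R = q^(t-1), N ≤ R would give R q = 1 + N(q - 1) ≤ 1 + R(q - 1), hence R ≤ 1, whereas R ≥
  -- q.
  q^[t-1]<N : q ℕ.^ (t ∸ 1) < N
  q^[t-1]<N = ℕₚ.≰⇒> λ N≤R → ℕₚ.<⇒≱ (ℕₚ.≤-trans (s≤s (s≤s z≤n)) (ℕₚ.≤-trans 3<q q≤q^[t-1]))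
    (ℕₚ.+-cancelʳ-≤ (R ℕ.* (q ∸ 1)) R 1 (begin
      R ℕ.+ R ℕ.* (q ∸ 1)     ≡⟨ ℕₚ.*-suc R (q ∸ 1) ⟨
      R ℕ.* suc (q ∸ 1)       ≡⟨ cong (R ℕ.*_) q≡ ⟨
      R ℕ.* q                 ≡⟨ trans (ℕₚ.*-comm R q) (trans (sym q^t≡) (sym count)) ⟩
      suc (N ℕ.* (q ∸ 1))     ≤⟨ s≤s (ℕₚ.*-monoˡ-≤ (q ∸ 1) N≤R) ⟩
      suc (R ℕ.* (q ∸ 1))     ∎))
    where
    R : ℕ
    R = q ℕ.^ (t ∸ 1)

  1<N : 1 < N
  1<N = ℕₚ.≤-<-trans (ℕₚ.≤-trans (s≤s z≤n) (ℕₚ.≤-trans 3<q q≤q^[t-1])) q^[t-1]<N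

  -- As t ≥ 2, q^t = q · q^(t-1) is at most the square of q^(t-1), which is below N².
  q^t<N*N : q ℕ.^ t < N ℕ.* N
  q^t<N*N = begin-strict
    q ℕ.^ t                               ≡⟨ q^t≡ ⟩
    q ℕ.* q ℕ.^ (t ∸ 1)                   ≤⟨ ℕₚ.*-monoˡ-≤ (q ℕ.^ (t ∸ 1)) q≤q^[t-1] ⟩
    q ℕ.^ (t ∸ 1) ℕ.* q ℕ.^ (t ∸ 1)       <⟨ ℕₚ.*-mono-< q^[t-1]<N q^[t-1]<N ⟩
    N ℕ.* N                               ∎

  q<q^t : q < q ℕ.^ t
  q<q^t = begin-strict
    q                ≡⟨ ℕₚ.^-identityʳ q ⟨
    q ℕ.^ 1          <⟨ ℕₚ.^-monoʳ-< q (ℕₚ.≤-trans (s≤s (s≤s z≤n)) 3<q) 1<t ⟩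
    q ℕ.^ t          ∎

-- Isomorphisms between the planes of two scattered polynomials

module IsomorphismTheory {q t N : ℕ} (q-primePower : IsPrimePower q) (3<q : 3 < q) (1<t : 1 < t) (E : FieldExtension q t)
  (count : suc (N ℕ.* (q ∸ 1)) ≡ q ℕ.^ t) where

  open Counting {q} {t} {N} 3<q 1<t count

  1<q : 1 < q
  1<q = ℕₚ.≤-trans (s≤s (s≤s z≤n)) 3<q

  open SemilinearTheory q-primePower 1<q E public
  open ≡-Reasoning

  -- The N classes of nonzero scalars, detached from the subspace that produced them: one labelling
  -- bounds both the slopes of f and the multiples of U_g.
  record ScalarClass : Set where
    field
      class        : ∀ x → x ≢ 0# → Fin N
      proportional : ∀ {x y} (x≢0 : x ≢ 0#) (y≢0 : y ≢ 0#) → class x x≢0 ≡ class y y≢0 → ∃[ c ] y ≡ ι c * x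

  module PlaneIsomorphism (scalarClass : ScalarClass)
    {f g : LinearizedPolynomial} (f-linear : IsKLinear (eval f)) (f-scattered : IsScatteredPolynomial f)
    (g-linear : IsKLinear (eval g)) (g-scattered : IsScatteredPolynomial g)
    (iso : 𝒜 f ≅ 𝒜 g) where

    open ScalarClass scalarClass
    module Sf = ScatteredSpread f f-linear f-scattered
    module Sg = ScatteredSpread g g-linear g-scattered
    open Collineation Sf.spread-isSpread Sg.spread-isSpread (proj₁ iso) (proj₁ (proj₁ (proj₂ iso))) (proj₁ (proj₂ (proj₂ iso)))
    open AdditiveMap ψ ψ-+ ψ-0 ψ-injective

    -- The proof that m is not a slope of f is part of the spread index, and `imageIndex` may depend
    -- on it, so `BadSlope` stores it.
    BadSlope GoodSlope NonSlope : F → Set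
    BadSlope m  = Σ (¬ Slopes f m) λ m∉ → ∃[ h ] Σ (h ≢ 0#) λ h≢0 → imageIndex (slope m m∉) ≡ multiple h h≢0
    GoodSlope m = MapsToLine (1# , m)
    NonSlope m  = BadSlope m ⊎ GoodSlope m

    1,m∈ : ∀ m → ⟨ 1# , m ⟩ (1# , m)
    1,m∈ m = self∈⟨⟩ (1# , m)

    line⇒good : ∀ {m} w → (∀ x → ∃[ y ] ψ (x · (1# , m)) ≡ y · w) → GoodSlope m
    line⇒good {m} w onto x with y , ψx≡ ← onto x | z , ψ1≡ ← onto 1# = y * z ⁻¹ , (begin
      ψ (x · (1# , m))            ≡⟨ ψx≡ ⟩
      y · w                       ≡⟨ cong (y ·_) (x⁻¹·x·v≡v z≢0 w) ⟨
      y · z ⁻¹ · z · w            ≡⟨ ·-assoc y (z ⁻¹) (z · w) ⟨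
      (y * z ⁻¹) · z · w          ≡⟨ cong ((y * z ⁻¹) ·_) (trans (sym ψ1≡) (cong ψ (·-identity (1# , m)))) ⟩
      (y * z ⁻¹) · ψ (1# , m)     ∎)
      where
      z≢0 : z ≢ 0#
      z≢0 = ·-nonzeroˡ (subst (_≢ 0ᵥ) ψ1≡ (ψ-nonzero (·-nonzero 1≢0 1,m≢0)))

    -- A member of the target spread other than a multiple of U_g is an 𝔽_{q^t}-line.
    classify : ∀ m → ¬ Slopes f m → NonSlope m
    classify m m∉ = by-image (imageIndex (slope m m∉)) refl
      where
      by-image : ∀ j → imageIndex (slope m m∉) ≡ j → NonSlope m
      by-image (multiple h h≢0) eq = inj₁ (m∉ , h , h≢0 , eq)
      by-image j@(slope m′ _)   eq = inj₂ (line⇒good (1# , m′) λ x →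
        subst (λ j → spread g j (ψ (x · (1# , m)))) eq (ψ-component (slope m m∉) (x , refl)))
      by-image vertical         eq = inj₂ (line⇒good (0# , 1#) λ x →
        proj₂ (ψ (x · (1# , m))) , cong₂ _,_
          (trans (subst (λ j → spread g j (ψ (x · (1# , m)))) eq (ψ-component (slope m m∉) (x , refl))) (sym (zeroʳ _)))
          (sym (*-identityʳ _)))

    slope? : ∀ m → Slopes f m ⊎ NonSlope m
    slope? m with ∃? (λ x → ¬? (x ≟ 0#) ×-dec (m ≟ eval f x * x ⁻¹))
    ... | yes m∈ = inj₁ m∈
    ... | no m∉  = inj₂ (classify m m∉)

    -- The quotient f(x)/x is unchanged when x is scaled by 𝔽_q^*, so distinct slopes have arguments
    -- in distinct classes.
    slopes-bound : ∀ {a} (s : Fin a → F) → Injective _≡_ _≡_ s → (∀ i → Slopes f (s i)) → a ≤ N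
    slopes-bound s s-injective slopes = injective⇒≤ {f = λ i → class (proj₁ (slopes i)) (proj₁ (proj₂ (slopes i)))}
      λ {i} {j} eq → s-injective (equal (slopes i) (slopes j) (proportional _ _ eq))
      where
      equal : ∀ {m m′} ((x , _ , _) : Slopes f m) ((y , _ , _) : Slopes f m′) → ∃[ c ] y ≡ ι c * x → m ≡ m′
      equal {m} {m′} (x , x≢0 , m≡) (y , y≢0 , m′≡) (c , refl) = *-cancelˡ y≢0 (begin
        ι c * x * m                       ≡⟨ cong (ι c * x *_) m≡ ⟩
        ι c * x * (eval f x * x ⁻¹)       ≡⟨ solve 4 (λ c x w n → c :* x :* (w :* n) := c :* (x :* (n :* w))) refl (ι c) x (eval f x) (x ⁻¹) ⟩
        ι c * (x * (x ⁻¹ * eval f x))     ≡⟨ cong (ι c *_) (x*[x⁻¹*y]≡y x≢0 (eval f x)) ⟩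
        ι c * eval f x                    ≡⟨ IsKLinear.·-homo f-linear c x ⟨
        eval f y                          ≡⟨ x*[x⁻¹*y]≡y y≢0 (eval f y) ⟨
        y * (y ⁻¹ * eval f y)             ≡⟨ cong (y *_) (trans (*-comm _ _) (sym m′≡)) ⟩
        y * m′                            ∎)

    -- If h and h′ share a class, then h U_g = h′ U_g, so the lines of slopes m and m′ have the same
    -- image; reflecting (1 , m′) through ψ gives m = m′.
    bad-bound : ∀ {a} (s : Fin a → F) → Injective _≡_ _≡_ s → (∀ i → BadSlope (s i)) → a ≤ N
    bad-bound s s-injective bad = injective⇒≤ {f = λ i → class (proj₁ (proj₂ (bad i))) (proj₁ (proj₂ (proj₂ (bad i))))}
      λ {i} {j} eq → s-injective (equal (bad i) (bad j) (proportional _ _ eq))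
      where
      equal : ∀ {m m′} ((_ , h , _) : BadSlope m) ((_ , h′ , _) : BadSlope m′) → ∃[ c ] h′ ≡ ι c * h → m ≡ m′
      equal {m} {m′} (m∉ , h , h≢0 , j≡) (m′∉ , h′ , h′≢0 , j′≡) (c , h′≡) = same-line
        (ψ-component-reflect (slope m m∉) (subst (λ j → spread g j (ψ (1# , m′))) (sym j≡)
          (Sg.multiple-⊆ c (trans h′≡ (*-comm (ι c) h)) (subst (λ j → spread g j (ψ (1# , m′))) j′≡ (ψ-component (slope m′ m′∉) (1,m∈ m′))))))
        where
        same-line : ⟨ 1# , m ⟩ (1# , m′) → m ≡ m′
        same-line (x , eq) = begin
          m          ≡⟨ *-identityˡ m ⟨
          1# * m     ≡⟨ cong (_* m) (trans (cong proj₁ eq) (*-identityʳ x)) ⟩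
          x * m      ≡⟨ cong proj₂ eq ⟨
          m′         ∎

    many-good : Σ (Fin (suc N) → F) λ s → Injective _≡_ _≡_ s × (∀ i → GoodSlope (s i))
    many-good =
      let a , b , a+b≡ , (s , s-injective , s-slope) , (r , r-injective , r-nonslope) = partition (slope? ∘ element)
          c , d , c+d≡ , (u , u-injective , u-bad) , (v , v-injective , v-good) = partition r-nonslope
          N<d : suc N ≤ d
          N<d = many-remain {a} {c} {d} (trans (cong (a ℕ.+_) c+d≡) a+b≡)
                  (slopes-bound (element ∘ s) (s-injective ∘ element-injective) s-slope)
                  (bad-bound (element ∘ r ∘ u) (u-injective ∘ r-injective ∘ element-injective) u-bad)
      in (λ i → element (r (v (inject≤ i N<d)))) ,
         (λ eq → inject≤-injective N<d N<d _ _ (v-injective (r-injective (element-injective eq)))) ,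
         (λ i → v-good (inject≤ i N<d))

    ψ-semilinear : ∃[ σ ] (IsRingIsomorphism rawRing rawRing σ × (∀ x v → ψ (x · v) ≡ σ x · ψ v))
    ψ-semilinear = from-lines N refl 1<N many-good
      where
      -- N is replaced by a variable so that it can be matched as 2 + n, which turns its N + 1 good
      -- slopes into the 3 + n of `ManyLines`.
      from-lines : ∀ N′ → N ≡ N′ → 1 < N′ → (Σ (Fin (suc N′) → F) λ s → Injective _≡_ _≡_ s × (∀ i → GoodSlope (s i))) →
                   ∃[ σ ] (IsRingIsomorphism rawRing rawRing σ × (∀ x v → ψ (x · v) ≡ σ x · ψ v))
      from-lines (suc zero)    _    (s≤s ()) _
      from-lines (suc (suc n)) N≡N′ _ (s , s-injective , good) = L₀.A , A-automorphism , ψ-·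
        where open ManyLines {n} s s-injective good (subst (λ x → q ℕ.^ t < x ℕ.* x) N≡N′ q^t<N*N)

    σ : F → F
    σ = proj₁ ψ-semilinear

    ψ-· : ∀ x v → ψ (x · v) ≡ σ x · ψ v
    ψ-· = proj₂ (proj₂ ψ-semilinear)

    U : SpreadIndex f
    U = multiple 1# 1≢0

    -- Closure would put every x · (1 , f 1) into U_f, so f(x) = x f(1) for all x. Since f is
    -- scattered, each x would then be an 𝔽_q-multiple of 1, contrary to q < q^t.
    ¬F-closed : ¬ (∀ x {v} → spread f U v → spread f U (x · v))
    ¬F-closed closed = ℕₚ.<⇒≱ q<q^t (injective⇒≤ {f = λ i → K.index (proj₁ (scalar (element i)))}
      λ {i} {j} eq → element-injective (trans (proj₂ (scalar (element i)))
        (trans (cong (λ c → ι c * 1#) (K.index-injective eq)) (sym (proj₂ (scalar (element j)))))))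
      where
      scalar : ∀ x → ∃[ c ] x ≡ ι c * 1#
      scalar x with x ≟ 0#
      ... | yes x≡0 = K.0# , trans x≡0 (sym (trans (cong (_* 1#) ι-0) (zeroˡ 1#)))
      ... | no x≢0 = Sf.proportional 1≢0 x≢0 (slope≡ (closed x (Sf.member∈ U 1#)))
        where
        slope≡ : spread f U (x · Sf.member U 1#) → x * eval f 1# ≡ 1# * eval f x
        slope≡ (_ , (z , refl) , eq) = begin
          x * eval f 1#            ≡⟨ cong (x *_) (*-identityˡ (eval f 1#)) ⟨
          x * (1# * eval f 1#)     ≡⟨ cong proj₂ eq ⟨
          1# * eval f z            ≡⟨ cong (λ z → 1# * eval f z) z≡x ⟩
          1# * eval f x            ∎
          where
          z≡x : z ≡ x
          z≡x = trans (sym (*-identityˡ z)) (trans (cong proj₁ eq) (solve 1 (λ x → x :* (:1 :* :1) := x) refl x))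

    -- Semilinearity pulls closure under scalars back: x acts on U_f as σ x acts on its image. This
    -- excludes the 𝔽_{q^t}-lines as images of U_f.
    image-F-closed⇒⊥ : ¬ (∀ x {v} → spread g (imageIndex U) v → spread g (imageIndex U) (x · v))
    image-F-closed⇒⊥ closed = ¬F-closed λ x {v} v∈ →
      ψ-component-reflect U (subst (spread g (imageIndex U)) (sym (ψ-· x v)) (closed (σ x) (ψ-component U v∈)))

    image-multiple : ∃[ h ] Σ (h ≢ 0#) λ h≢0 → imageIndex U ≡ multiple h h≢0
    image-multiple = by-image (imageIndex U) refl
      where
      by-image : ∀ j → imageIndex U ≡ j → ∃[ h ] Σ (h ≢ 0#) λ h≢0 → imageIndex U ≡ multiple h h≢0
      by-image (multiple h h≢0) eq = h , h≢0 , eq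
      by-image (slope m m∉)     eq = contradiction
        (subst (λ j → ∀ x {v} → spread g j v → spread g j (x · v)) (sym eq) λ { x (y , refl) → x * y , sym (·-assoc x y (1# , m)) }) image-F-closed⇒⊥
      by-image vertical         eq = contradiction
        (subst (λ j → ∀ x {v} → spread g j v → spread g j (x · v)) (sym eq) λ { x {_ , _} refl → zeroʳ x }) image-F-closed⇒⊥

    h : F
    h = proj₁ image-multiple

    h≢0 : h ≢ 0#
    h≢0 = proj₁ (proj₂ image-multiple)

    θ : V → V
    θ v = h ⁻¹ · ψ v

    θ-injective : Injective _≡_ _≡_ θ
    θ-injective = ψ-injective ∘ ·-cancelˡ (nonzero-⁻¹ h≢0)

    θ-ΓL : ΓL
    θ-ΓL = record
      { σ = σ ; κ = θ
      ; automorphism = proj₁ (proj₂ ψ-semilinear)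
      ; semilinear = record
        { +-homo = λ u v → trans (cong (h ⁻¹ ·_) (ψ-+ u v)) (·-distribˡ (h ⁻¹) (ψ u) (ψ v))
        ; ·-homo = λ x v → trans (cong (h ⁻¹ ·_) (ψ-· x v)) (·-comm (h ⁻¹) (σ x) (ψ v)) }
      ; bijective = θ-injective , λ v → let u , θu≡v = pair-injective⇒onto θ-injective v in u , λ { refl → θu≡v } }

    graph⇔U : ∀ {v} → (graph f v → spread f U v) × (spread f U v → graph f v)
    graph⇔U {v} = (λ v∈ → v , v∈ , ·-identity v) , λ { (w , w∈ , refl) → subst (graph f) (sym (·-identity w)) w∈ }

    θ-graph : ∀ {v} → graph f v → graph g (θ v)
    θ-graph {v} v∈ = divide (subst (λ j → spread g j (ψ v)) (proj₂ (proj₂ image-multiple)) (ψ-component U (proj₁ graph⇔U v∈)))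
      where
      divide : image (h ·_) (graph g) (ψ v) → graph g (θ v)
      divide (w , w∈ , hw≡) = subst (graph g) (trans (sym (x⁻¹·x·v≡v h≢0 w)) (cong (h ⁻¹ ·_) hw≡)) w∈

    θ-graph-onto : ∀ {w} → graph g w → ∃[ v ] (graph f v × θ v ≡ w)
    θ-graph-onto {w} w∈ =
      let v , v∈ , ψv≡ = ψ-component-onto U (subst (λ j → spread g j (h · w)) (sym (proj₂ (proj₂ image-multiple))) (w , w∈ , refl))
      in v , proj₂ graph⇔U v∈ , trans (cong (h ⁻¹ ·_) ψv≡) (x⁻¹·x·v≡v h≢0 w)

-- From isomorphic planes to equivalent subspaces

module Conclusion {q t N : ℕ} (q-primePower : IsPrimePower q) (3<q : 3 < q) (1<t : 1 < t) (E : FieldExtension q t)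
  (count : suc (N ℕ.* (q ∸ 1)) ≡ q ℕ.^ t)
  {L : Pred (Geometry.Point E) 0ℓ} (L-card : Geometry.HasCardinality E L N) where

  open IsomorphismTheory {N = N} q-primePower 3<q 1<t E count
  open PointCount L-card count public

  module _ (U : Subspace) (L-U : LinearSet (carrier U) ≐ L) where
    private module U = GraphOfSubspace U L-U

    scalarClass : ScalarClass
    scalarClass = record { class = U.class ; proportional = U.class-proportional }

    -- Both graphs are images under the same linear κ, so conjugating by κ turns the semilinear map
    -- between the graphs into one between the subspaces.
    isomorphic⇒ΓL-equivalent : ∀ W (L-W : LinearSet (carrier W) ≐ L) →
      𝒜 (GraphOfSubspace.f U L-U) ≅ 𝒜 (GraphOfSubspace.f W L-W) → ΓL-Equivalent W U
    isomorphic⇒ΓL-equivalent W L-W iso = record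
      { σ = I.σ ; κ = τ ; automorphism = ΓL.automorphism I.θ-ΓL
      ; semilinear = record
        { +-homo = λ u v → trans (cong (κ⁻¹ ∘ I.θ) (κ-+ u v)) (trans (cong κ⁻¹ (θ.+-homo (κ u) (κ v))) (κ⁻¹-+ _ _))
        ; ·-homo = λ x v → trans (cong (κ⁻¹ ∘ I.θ) (κ-· x v)) (trans (cong κ⁻¹ (θ.·-homo x (κ v))) (κ⁻¹-· _ _)) }
      ; bijective = τ-injective , λ v → let u , τu≡v = pair-injective⇒onto τ-injective v in u , λ { refl → τu≡v } } , W⊆ , ⊆W
      where
      module W = GraphOfSubspace W L-W
      module I = PlaneIsomorphism scalarClass U.f-linear U.f-scattered W.f-linear W.f-scattered iso
      module θ = IsSemilinear (ΓL.semilinear I.θ-ΓL)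

      τ : V → V
      τ = κ⁻¹ ∘ I.θ ∘ κ

      τ-injective : Injective _≡_ _≡_ τ
      τ-injective {u} {v} eq = κ-injective (I.θ-injective (trans (sym (κ∘κ⁻¹ _)) (trans (cong κ eq) (κ∘κ⁻¹ _))))

      W⊆ : ∀ {v} → carrier W v → image τ (carrier U) v
      W⊆ {v} v∈W =
        let w , w∈ , θw≡κv = I.θ-graph-onto (W.κ-U⊆graph v∈W)
            u , u∈U , κu≡w = U.graph⊆κ-U w∈
        in u , u∈U , trans (cong κ⁻¹ (trans (cong I.θ κu≡w) θw≡κv)) (κ⁻¹∘κ v)

      ⊆W : ∀ {v} → image τ (carrier U) v → carrier W v
      ⊆W (u , u∈U , refl) =
        let w , w∈W , κw≡ = W.graph⊆κ-U (I.θ-graph (U.κ-U⊆graph u∈U))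
        in subst (carrier W) (trans (sym (κ⁻¹∘κ w)) (cong κ⁻¹ κw≡)) w∈W

corollary4p6 : (q t : ℕ) → IsPrimePower q → 3 < q → 1 < t →
    (E : FieldExtension q t) →
    let open Geometry E in
    (U : Subspace) → IsScatteredOfRank U t →
    (c : ℕ) → IsΓLClass (LinearSet (carrier U)) c →
    Σ GL λ κ → Σ (Fin c → LinearizedPolynomial) λ f →
    (∀ i → IsScatteredPolynomial (f i))
    × (∀ i → LinearSet (graph (f i)) ≐ imageₚ (projectivity κ) (LinearSet (carrier U)))
    × (∀ i j → i ≢ j → ¬ (𝒜 (f i) ≅ 𝒜 (f j)))
corollary4p6 q t q-primePower 3<q 1<t E U (_ , N , L-card , N*[q-1]≡q^t-1) c ((W , L-W , inequivalent) , _) =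
  -- κ comes from the point outside L, before any `W i` is considered; `(id , id)` says that the
  -- given U has its own linear set.
  κ-GL , (λ i → G.f i) , G.f-scattered , (λ i → G.LinearSet-graph i {U} (id , id)) ,
  -- The indices are swapped because an isomorphism from the plane of `f i` to that of `f j`
  -- presents `W j` as an image of `W i`.
  λ i j i≢j iso → inequivalent j i (i≢j ∘ sym) (isomorphic⇒ΓL-equivalent (W i) (L-W i) (W j) (L-W j) iso)
  where
  count : suc (N ℕ.* (q ∸ 1)) ≡ q ℕ.^ t
  count = trans (cong suc N*[q-1]≡q^t-1)
    (ℕₚ.m+[n∸m]≡n (ℕₚ.m^n>0 q {{ℕ.>-nonZero (ℕₚ.<-trans (s≤s z≤n) 3<q)}} t))
  open Conclusion q-primePower 3<q 1<t E count L-card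
  module G i = GraphOfSubspace (W i) (L-W i)
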